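{- Let $n\geq 2$. There is a constant $C_n>0$ depending only on $n$ such that, for every finite set $L$ of lines in $\mathbb{R}^n$, the set $J$ of joints of $L$ satisfies $|J|\leq C_n|L|^{n/(n-1)}$.
   Context: For a set $L$ of lines in $\mathbb{R}^n$, a joint of $L$ is a point $x\in\mathbb{R}^n$ for which there exist lines $\ell_1,\dots,\ell_n\in L$, all passing through $x$, whose directions are linearly independent (so $\{x\}=\bigcap_{i=1}^n\ell_i$). The set of all joints of $L$ is denoted $J$. $|S|$ denotes the cardinality of a set $S$. -}

module Defs where

open import Algebra.Bundles using (RawSemiring)
import Algebra.Definitions.RawMonoid as RawMonoidDefs
open import Data.Fin.Base using (Fin)
open import Data.Integer.Base as ℤ using (+_)
import Data.Integer.Properties as ℤ
open import Data.Nat.Base as ℕ using (ℕ; zero; suc)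
import Data.Nat.Properties as ℕ
open import Data.Product.Base using (_×_; _,_; ∃; ∃-syntax; Σ-syntax; proj₁; proj₂)
open import Data.Rational.Base as ℚ using (ℚ; mkℚ; 0ℚ; 1ℚ; ½; ∣_∣)
import Data.Rational.Properties as ℚ
open import Data.Rational.Solver using (module +-*-Solver)
import Data.Rational.Unnormalised.Base as ℚᵘ
import Data.Rational.Unnormalised.Properties as ℚᵘ
open import Data.Sum.Base using (inj₁; inj₂)
open import Data.Vec.Functional using (Vector)
import Data.Vec.Functional.Relation.Binary.Equality.Setoid as VectorEquality
open import Function.Bundles using (Bijection; Injection; _⇔_; mk⇔; Equivalence)
open import Level using (Level; 0ℓ; _⊔_)
open import Relation.Binary.Bundles using (Setoid)
import Relation.Binary.Construct.On as On
open import Relation.Binary.PropositionalEquality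
  using (_≡_; refl; sym; trans; cong; subst; subst₂; module ≡-Reasoning)
  renaming (setoid to ≡-setoid)
open import Relation.Nullary using (¬_; yes; no; contradiction)
open import Relation.Unary using (Pred)

open +-*-Solver using (solve; _:=_; _:+_; _:*_; _:-_; :-_)

private variable
  a ℓ p : Level

-- A real is a Cauchy sequence of rationals; the quotient by null sequences is
-- replaced by the setoid equality _≈_.

IsCauchy : (ℕ → ℚ) → Set
IsCauchy x = ∀ ε → 0ℚ ℚ.< ε →
  ∃[ N ] (∀ i j → N ℕ.≤ i → N ℕ.≤ j → ∣ x i ℚ.- x j ∣ ℚ.< ε)

record ℝ : Set where
  constructor mkℝ
  field
    seq    : ℕ → ℚ
    cauchy : IsCauchy seq

open ℝ public

infix 4 _≈_ _≤_ _<_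

_≈_ : ℝ → ℝ → Set
x ≈ y = ∀ ε → 0ℚ ℚ.< ε →
  ∃[ N ] (∀ i → N ℕ.≤ i → ∣ seq x i ℚ.- seq y i ∣ ℚ.< ε)

_≤_ : ℝ → ℝ → Set
x ≤ y = ∀ ε → 0ℚ ℚ.< ε →
  ∃[ N ] (∀ i → N ℕ.≤ i → seq x i ℚ.< seq y i ℚ.+ ε)

_<_ : ℝ → ℝ → Set
x < y = ∃[ ε ] (0ℚ ℚ.< ε ×
  ∃[ N ] (∀ i → N ℕ.≤ i → seq x i ℚ.+ ε ℚ.≤ seq y i))

private
  x-y+y-z : ∀ x y z → (x ℚ.- y) ℚ.+ (y ℚ.- z) ≡ x ℚ.- z
  x-y+y-z = solve 3 (λ x y z → (x :- y) :+ (y :- z) := x :- z) refl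

  x-y+y : ∀ x y → (x ℚ.- y) ℚ.+ y ≡ x
  x-y+y = solve 2 (λ x y → (x :- y) :+ y := x) refl

  x+y-x : ∀ x y → (x ℚ.+ y) ℚ.- x ≡ y
  x+y-x = solve 2 (λ x y → (x :+ y) :- x := y) refl

  -[x-y] : ∀ x y → ℚ.- (x ℚ.- y) ≡ y ℚ.- x
  -[x-y] = solve 2 (λ x y → :- (x :- y) := y :- x) refl

  +-difference : ∀ a b c d → (a ℚ.- b) ℚ.+ (c ℚ.- d) ≡ (a ℚ.+ c) ℚ.- (b ℚ.+ d)
  +-difference = solve 4 (λ a b c d → (a :- b) :+ (c :- d) := (a :+ c) :- (b :+ d)) refl

  *-difference : ∀ a b c d → a ℚ.* (c ℚ.- d) ℚ.+ d ℚ.* (a ℚ.- b) ≡ a ℚ.* c ℚ.- b ℚ.* d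
  *-difference =
    solve 4 (λ a b c d → (a :* (c :- d)) :+ (d :* (a :- b)) := (a :* c) :- (b :* d)) refl

  half+half : ∀ ε → ½ ℚ.* ε ℚ.+ ½ ℚ.* ε ≡ ε
  half+half ε = trans (sym (ℚ.*-distribʳ-+ ε ½ ½)) (ℚ.*-identityˡ ε)

  half-pos : ∀ {ε} → 0ℚ ℚ.< ε → 0ℚ ℚ.< ½ ℚ.* ε
  half-pos 0<ε = ℚ.*-monoʳ-<-pos ½ 0<ε

  ∣x-y∣≡∣y-x∣ : ∀ x y → ∣ x ℚ.- y ∣ ≡ ∣ y ℚ.- x ∣
  ∣x-y∣≡∣y-x∣ x y = trans (sym (ℚ.∣-p∣≡∣p∣ (x ℚ.- y)))
    (cong ∣_∣ (-[x-y] x y))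
  ∣x-x∣<ε : ∀ x {ε} → 0ℚ ℚ.< ε → ∣ x ℚ.- x ∣ ℚ.< ε
  ∣x-x∣<ε x 0<ε = subst (λ z → ∣ z ∣ ℚ.< _) (sym (ℚ.+-inverseʳ x)) 0<ε

  ∣u+v∣<ε : ∀ u v {ε} → ∣ u ∣ ℚ.< ½ ℚ.* ε → ∣ v ∣ ℚ.< ½ ℚ.* ε → ∣ u ℚ.+ v ∣ ℚ.< ε
  ∣u+v∣<ε u v {ε} u< v< = ℚ.≤-<-trans (ℚ.∣p+q∣≤∣p∣+∣q∣ u v)
    (subst (_ ℚ.<_) (half+half ε) (ℚ.+-mono-< u< v<))

≈-refl : ∀ {x} → x ≈ x
≈-refl {x} ε 0<ε = 0 , λ i _ → ∣x-x∣<ε (seq x i) 0<ε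

≈-sym : ∀ {x y} → x ≈ y → y ≈ x
≈-sym {x} {y} x≈y ε 0<ε with x≈y ε 0<ε
... | N , h = N , λ i N≤i →
  subst (ℚ._< ε) (∣x-y∣≡∣y-x∣ (seq x i) (seq y i)) (h i N≤i)

≈-trans : ∀ {x y z} → x ≈ y → y ≈ z → x ≈ z
≈-trans {x} {y} {z} x≈y y≈z ε 0<ε
  with x≈y (½ ℚ.* ε) (half-pos 0<ε) | y≈z (½ ℚ.* ε) (half-pos 0<ε)
... | M , f | N , g = M ℕ.⊔ N , λ i le →
  subst (λ w → ∣ w ∣ ℚ.< ε)
    (x-y+y-z (seq x i) (seq y i) (seq z i))
    (∣u+v∣<ε (seq x i ℚ.- seq y i) (seq y i ℚ.- seq z i)
      (f i (ℕ.m⊔n≤o⇒m≤o M N le)) (g i (ℕ.m⊔n≤o⇒n≤o M N le)))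

ℝ-setoid : Setoid 0ℓ 0ℓ
ℝ-setoid = record
  { Carrier       = ℝ
  ; _≈_           = _≈_
  ; isEquivalence = record
    { refl  = λ {x} → ≈-refl {x}
    ; sym   = λ {x} {y} → ≈-sym {x} {y}
    ; trans = λ {x} {y} {z} → ≈-trans {x} {y} {z}
    }
  }

fromℚ : ℚ → ℝ
fromℚ q = mkℝ (λ _ → q) (λ ε 0<ε → 0 , λ _ _ _ _ → ∣x-x∣<ε q 0<ε)

fromℕ : ℕ → ℝ
fromℕ n = fromℚ (+ n ℚ./ 1)

0ℝ 1ℝ : ℝ
0ℝ = fromℚ 0ℚ
1ℝ = fromℚ 1ℚ

infixl 6 _+_
infixl 7 _*_

_+_ : ℝ → ℝ → ℝ
x + y = mkℝ (λ i → seq x i ℚ.+ seq y i) λ ε 0<ε →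
  let M , f = cauchy x (½ ℚ.* ε) (half-pos 0<ε)
      N , g = cauchy y (½ ℚ.* ε) (half-pos 0<ε)
  in M ℕ.⊔ N , λ i j le le′ →
    subst (λ w → ∣ w ∣ ℚ.< ε)
      (+-difference (seq x i) (seq x j) (seq y i) (seq y j))
      (∣u+v∣<ε (seq x i ℚ.- seq x j) (seq y i ℚ.- seq y j)
        (f i j (ℕ.m⊔n≤o⇒m≤o M N le) (ℕ.m⊔n≤o⇒m≤o M N le′))
        (g i j (ℕ.m⊔n≤o⇒n≤o M N le) (ℕ.m⊔n≤o⇒n≤o M N le′)))

private
  eventually-bounded : ∀ x →
    ∃[ B ] (0ℚ ℚ.< B × ∃[ N ] (∀ i → N ℕ.≤ i → ∣ seq x i ∣ ℚ.≤ B))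
  eventually-bounded x with cauchy x 1ℚ (ℚ.positive⁻¹ 1ℚ)
  ... | N , h =
    1ℚ ℚ.+ ∣ xN ∣ ,
    ℚ.+-mono-<-≤ (ℚ.positive⁻¹ 1ℚ) (ℚ.0≤∣p∣ xN) ,
    N , λ i N≤i → subst (λ w → ∣ w ∣ ℚ.≤ 1ℚ ℚ.+ ∣ xN ∣)
      (x-y+y (seq x i) xN)
      (ℚ.≤-trans (ℚ.∣p+q∣≤∣p∣+∣q∣ (seq x i ℚ.- xN) xN)
        (ℚ.+-monoˡ-≤ ∣ xN ∣ (ℚ.<⇒≤ (h i N N≤i ℕ.≤-refl))))
    where
    xN = seq x N

  *-bound : ∀ {B δ} u v → 0ℚ ℚ.< B → ∣ u ∣ ℚ.≤ B → ∣ v ∣ ℚ.< δ →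
            ∣ u ℚ.* v ∣ ℚ.< B ℚ.* δ
  *-bound {B} {δ} u v 0<B u≤B v<δ = begin-strict
    ∣ u ℚ.* v ∣       ≡⟨ ℚ.∣p*q∣≡∣p∣*∣q∣ u v ⟩
    ∣ u ∣ ℚ.* ∣ v ∣   ≤⟨ ℚ.*-monoʳ-≤-nonNeg ∣ v ∣ {{ℚ.∣-∣-nonNeg v}} u≤B ⟩
    B ℚ.* ∣ v ∣       <⟨ ℚ.*-monoʳ-<-pos B {{ℚ.positive 0<B}} v<δ ⟩
    B ℚ.* δ           ∎
    where open ℚ.≤-Reasoning

  split-bound : ∀ A B ε → 0ℚ ℚ.< A → 0ℚ ℚ.< B → 0ℚ ℚ.< ε →
                ∃[ δ ] (0ℚ ℚ.< δ × A ℚ.* δ ℚ.+ B ℚ.* δ ≡ ε)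
  split-bound A B ε 0<A 0<B 0<ε = split (A ℚ.+ B) refl (ℚ.positive (ℚ.+-mono-< 0<A 0<B))
    where
    split : ∀ S → A ℚ.+ B ≡ S → ℚ.Positive S →
            ∃[ δ ] (0ℚ ℚ.< δ × A ℚ.* δ ℚ.+ B ℚ.* δ ≡ ε)
    split S A+B≡S S-pos = S⁻¹ ℚ.* ε ,
      subst (ℚ._< S⁻¹ ℚ.* ε) (ℚ.*-zeroʳ S⁻¹)
        (ℚ.*-monoʳ-<-pos S⁻¹ {{ℚ.1/pos⇒pos S {{S-pos}}}} 0<ε) ,
      (begin
        A ℚ.* (S⁻¹ ℚ.* ε) ℚ.+ B ℚ.* (S⁻¹ ℚ.* ε)   ≡⟨ ℚ.*-distribʳ-+ (S⁻¹ ℚ.* ε) A B ⟨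
        (A ℚ.+ B) ℚ.* (S⁻¹ ℚ.* ε)                 ≡⟨ cong (ℚ._* (S⁻¹ ℚ.* ε)) A+B≡S ⟩
        S ℚ.* (S⁻¹ ℚ.* ε)                         ≡⟨ ℚ.*-assoc S S⁻¹ ε ⟨
        S ℚ.* S⁻¹ ℚ.* ε                           ≡⟨ cong (ℚ._* ε) (ℚ.*-inverseʳ S {{S-nz}}) ⟩
        1ℚ ℚ.* ε                                  ≡⟨ ℚ.*-identityˡ ε ⟩
        ε                                         ∎)
      where
      open ≡-Reasoning
      S-nz = ℚ.pos⇒nonZero S {{S-pos}}
      S⁻¹ = (ℚ.1/ S) {{S-nz}}

  *-close : ∀ {A B δ ε} a b c d → 0ℚ ℚ.< A → 0ℚ ℚ.< B → A ℚ.* δ ℚ.+ B ℚ.* δ ≡ ε →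
            ∣ a ∣ ℚ.≤ A → ∣ d ∣ ℚ.≤ B → ∣ a ℚ.- b ∣ ℚ.< δ → ∣ c ℚ.- d ∣ ℚ.< δ →
            ∣ a ℚ.* c ℚ.- b ℚ.* d ∣ ℚ.< ε
  *-close {A} {B} {δ} {ε} a b c d 0<A 0<B δ-sum a≤A d≤B a-b<δ c-d<δ = begin-strict
    ∣ a ℚ.* c ℚ.- b ℚ.* d ∣                             ≡⟨ cong ∣_∣ (*-difference a b c d) ⟨
    ∣ a ℚ.* (c ℚ.- d) ℚ.+ d ℚ.* (a ℚ.- b) ∣             ≤⟨ ℚ.∣p+q∣≤∣p∣+∣q∣ (a ℚ.* (c ℚ.- d)) (d ℚ.* (a ℚ.- b)) ⟩
    ∣ a ℚ.* (c ℚ.- d) ∣ ℚ.+ ∣ d ℚ.* (a ℚ.- b) ∣         <⟨ ℚ.+-mono-< (*-bound a (c ℚ.- d) 0<A a≤A c-d<δ)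
                                                                     (*-bound d (a ℚ.- b) 0<B d≤B a-b<δ) ⟩
    A ℚ.* δ ℚ.+ B ℚ.* δ                                 ≡⟨ δ-sum ⟩
    ε                                                   ∎
    where open ℚ.≤-Reasoning

  *-cauchy : ∀ x y → IsCauchy (λ i → seq x i ℚ.* seq y i)
  *-cauchy x y ε 0<ε =
    let A , 0<A , K , x≤A = eventually-bounded x
        B , 0<B , L , y≤B = eventually-bounded y
        δ , 0<δ , δ-sum   = split-bound A B ε 0<A 0<B 0<ε
        M , f = cauchy x δ 0<δ
        N , g = cauchy y δ 0<δ
    in (K ℕ.⊔ L) ℕ.⊔ (M ℕ.⊔ N) , λ i j le le′ →
      let iKL = ℕ.m⊔n≤o⇒m≤o (K ℕ.⊔ L) (M ℕ.⊔ N) le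
          iMN = ℕ.m⊔n≤o⇒n≤o (K ℕ.⊔ L) (M ℕ.⊔ N) le
          jKL = ℕ.m⊔n≤o⇒m≤o (K ℕ.⊔ L) (M ℕ.⊔ N) le′
          jMN = ℕ.m⊔n≤o⇒n≤o (K ℕ.⊔ L) (M ℕ.⊔ N) le′
      in *-close (seq x i) (seq x j) (seq y i) (seq y j) 0<A 0<B δ-sum
        (x≤A i (ℕ.m⊔n≤o⇒m≤o K L iKL))
        (y≤B j (ℕ.m⊔n≤o⇒n≤o K L jKL))
        (f i j (ℕ.m⊔n≤o⇒m≤o M N iMN) (ℕ.m⊔n≤o⇒m≤o M N jMN))
        (g i j (ℕ.m⊔n≤o⇒n≤o M N iMN) (ℕ.m⊔n≤o⇒n≤o M N jMN))

_*_ : ℝ → ℝ → ℝ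
x * y = mkℝ (λ i → seq x i ℚ.* seq y i) (*-cauchy x y)

ℝ-rawSemiring : RawSemiring 0ℓ 0ℓ
ℝ-rawSemiring = record
  { Carrier = ℝ ; _≈_ = _≈_ ; _+_ = _+_ ; _*_ = _*_ ; 0# = 0ℝ ; 1# = 1ℝ }

open RawMonoidDefs (RawSemiring.+-rawMonoid ℝ-rawSemiring) public using (sum)

-- For q ≠ 0, the largest r ≤ k with r ^ q ≤ b.
floorRootBelow : (q b k : ℕ) → ℕ
floorRootBelow q b zero    = 0
floorRootBelow q b (suc k) with suc k ℕ.^ q ℕ.≤? b
... | yes _ = suc k
... | no  _ = floorRootBelow q b k

-- ⌊ b^(1/q) ⌋ for q ≠ 0, as then r ^ q ≤ b implies r ≤ b.
floorRoot : (q b : ℕ) → ℕ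
floorRoot q b = floorRootBelow q b b

private
  floorRootBelow-≤ : ∀ q .{{_ : ℕ.NonZero q}} b k → floorRootBelow q b k ℕ.^ q ℕ.≤ b
  floorRootBelow-≤ (suc q) b zero    = ℕ.z≤n
  floorRootBelow-≤ q b (suc k) with suc k ℕ.^ q ℕ.≤? b
  ... | yes h = h
  ... | no  _ = floorRootBelow-≤ q b k

  floorRootBelow-> : ∀ q b k → b ℕ.< suc k ℕ.^ q → b ℕ.< suc (floorRootBelow q b k) ℕ.^ q
  floorRootBelow-> q b zero    h = h
  floorRootBelow-> q b (suc k) h with suc k ℕ.^ q ℕ.≤? b
  ... | yes _ = h
  ... | no ¬h = floorRootBelow-> q b k (ℕ.≰⇒> ¬h)

floorRoot-≤ : ∀ q .{{_ : ℕ.NonZero q}} b → floorRoot q b ℕ.^ q ℕ.≤ b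
floorRoot-≤ q b = floorRootBelow-≤ q b b

floorRoot-> : ∀ q .{{_ : ℕ.NonZero q}} b → b ℕ.< suc (floorRoot q b) ℕ.^ q
floorRoot-> (suc q) b = floorRootBelow-> (suc q) b b
  (ℕ.m≤m*n (suc b) (suc b ℕ.^ q) {{ℕ.m^n≢0 (suc b) q}})

private
  ^-cancelˡ-< : ∀ q {m n} → m ℕ.^ q ℕ.< n ℕ.^ q → m ℕ.< n
  ^-cancelˡ-< q h = ℕ.≰⇒> λ n≤m → ℕ.<⇒≱ h (ℕ.^-monoˡ-≤ q n≤m)

  frac : ℕ → ℕ → ℚ
  frac m d = + m ℚ./ suc d

  frac-mono : ∀ {m n} d e → m ℕ.* suc e ℕ.≤ n ℕ.* suc d → frac m d ℚ.≤ frac n e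
  frac-mono {m} {n} d e h = ℚ.toℚᵘ-cancel-≤
    (ℚᵘ.≤-respˡ-≃ (ℚᵘ.≃-sym (ℚ.toℚᵘ-fromℚᵘ (ℚᵘ.mkℚᵘ (+ m) d)))
    (ℚᵘ.≤-respʳ-≃ (ℚᵘ.≃-sym (ℚ.toℚᵘ-fromℚᵘ (ℚᵘ.mkℚᵘ (+ n) e)))
    (ℚᵘ.*≤* (subst₂ ℤ._≤_ (ℤ.pos-* m (suc e)) (ℤ.pos-* n (suc d)) (ℤ.+≤+ h)))))

  frac-suc : ∀ m d → frac (suc m) d ≡ frac m d ℚ.+ frac 1 d
  frac-suc m d = ℚ.toℚᵘ-injective (begin-equality
    ℚ.toℚᵘ (frac (suc m) d)                    ≃⟨ ℚ.toℚᵘ-fromℚᵘ (ℚᵘ.mkℚᵘ (+ suc m) d) ⟩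
    ℚᵘ.mkℚᵘ (+ suc m) d                        ≃⟨ ℚᵘ.*≡* add ⟩
    ℚᵘ.mkℚᵘ (+ m) d ℚᵘ.+ ℚᵘ.mkℚᵘ (+ 1) d       ≃⟨ ℚᵘ.+-cong (ℚ.toℚᵘ-fromℚᵘ (ℚᵘ.mkℚᵘ (+ m) d))
                                                            (ℚ.toℚᵘ-fromℚᵘ (ℚᵘ.mkℚᵘ (+ 1) d)) ⟨
    ℚ.toℚᵘ (frac m d) ℚᵘ.+ ℚ.toℚᵘ (frac 1 d)   ≃⟨ ℚ.toℚᵘ-homo-+ (frac m d) (frac 1 d) ⟨
    ℚ.toℚᵘ (frac m d ℚ.+ frac 1 d)             ∎)
    where
    open ℚᵘ.≤-Reasoning
    D = + suc d
    add : + suc m ℤ.* (+ (suc d ℕ.* suc d)) ≡ (+ m ℤ.* D ℤ.+ + 1 ℤ.* D) ℤ.* D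
    add = trans (cong (+ suc m ℤ.*_) (ℤ.pos-* (suc d) (suc d)))
      (trans (sym (ℤ.*-assoc (+ suc m) D D))
        (cong (ℤ._* D)
          (trans (cong (ℤ._* D) (ℤ.+-comm (+ 1) (+ m))) (ℤ.*-distribʳ-+ D (+ m) (+ 1)))))

  archimedean : ∀ ε → 0ℚ ℚ.< ε → ∃[ N ] (∀ i → N ℕ.≤ i → frac 1 i ℚ.< ε)
  archimedean ε@(mkℚ (+ suc k) d _) _ = suc d , λ i d<i → ℚ.toℚᵘ-cancel-<
    (ℚᵘ.<-respˡ-≃ (ℚᵘ.≃-sym (ℚ.toℚᵘ-fromℚᵘ (ℚᵘ.mkℚᵘ (+ 1) i)))
    (ℚᵘ.*<* (subst₂ ℤ._<_ (ℤ.pos-* 1 (suc d)) (ℤ.pos-* (suc k) (suc i)) (ℤ.+<+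
      (ℕ.≤-trans (ℕ.s≤s (subst (ℕ._≤ i) (sym (ℕ.*-identityˡ (suc d))) d<i))
        (ℕ.m≤n*m (suc i) (suc k)))))))
  archimedean (mkℚ (+ zero) d _) 0<ε = contradiction (ℚ.positive 0<ε) λ ()
  archimedean (mkℚ ℤ.-[1+ k ] d _) 0<ε = contradiction (ℚ.positive 0<ε) λ ()

  ^-distribʳ-* : ∀ q m n → (m ℕ.* n) ℕ.^ q ≡ m ℕ.^ q ℕ.* n ℕ.^ q
  ^-distribʳ-* zero    m n = refl
  ^-distribʳ-* (suc q) m n = trans (cong (m ℕ.* n ℕ.*_) (^-distribʳ-* q m n))
    (ℕ.[m*n]*[o*p]≡[m*o]*[n*p] m n (m ℕ.^ q) (n ℕ.^ q))

  ∣x-y∣<ε : ∀ x y {ε} → x ℚ.- y ℚ.< ε → y ℚ.- x ℚ.< ε → ∣ x ℚ.- y ∣ ℚ.< ε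
  ∣x-y∣<ε x y {ε} x-y< y-x< with ℚ.∣p∣≡p∨∣p∣≡-p (x ℚ.- y)
  ... | inj₁ eq = subst (ℚ._< ε) (sym eq) x-y<
  ... | inj₂ eq = subst (ℚ._< ε)
    (sym (trans eq (-[x-y] x y))) y-x<

-- r / (j + 1) is the largest fraction with denominator j + 1 whose q-th power
-- is ≤ b, hence within 1 / (j + 1) of b^(1/q).
rootNumerator : (q b j : ℕ) → ℕ
rootNumerator q b j = floorRoot q (b ℕ.* suc j ℕ.^ q)

private
  module _ (q : ℕ) .{{_ : ℕ.NonZero q}} (b : ℕ) where
    r : ℕ → ℕ
    r = rootNumerator q b

    r-cross : ∀ i j → r i ℕ.* suc j ℕ.< suc (r j) ℕ.* suc i
    r-cross i j = ^-cancelˡ-< q (begin-strict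
      (r i ℕ.* suc j) ℕ.^ q                       ≡⟨ ^-distribʳ-* q (r i) (suc j) ⟩
      r i ℕ.^ q ℕ.* suc j ℕ.^ q                   ≤⟨ ℕ.*-monoˡ-≤ (suc j ℕ.^ q) (floorRoot-≤ q (b ℕ.* suc i ℕ.^ q)) ⟩
      b ℕ.* suc i ℕ.^ q ℕ.* suc j ℕ.^ q           ≡⟨ ℕ.*-assoc b (suc i ℕ.^ q) (suc j ℕ.^ q) ⟩
      b ℕ.* (suc i ℕ.^ q ℕ.* suc j ℕ.^ q)         ≡⟨ cong (b ℕ.*_) (ℕ.*-comm (suc i ℕ.^ q) (suc j ℕ.^ q)) ⟩
      b ℕ.* (suc j ℕ.^ q ℕ.* suc i ℕ.^ q)         ≡⟨ ℕ.*-assoc b (suc j ℕ.^ q) (suc i ℕ.^ q) ⟨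
      b ℕ.* suc j ℕ.^ q ℕ.* suc i ℕ.^ q           <⟨ ℕ.*-monoˡ-< (suc i ℕ.^ q) {{ℕ.m^n≢0 (suc i) q}} (floorRoot-> q (b ℕ.* suc j ℕ.^ q)) ⟩
      suc (r j) ℕ.^ q ℕ.* suc i ℕ.^ q             ≡⟨ ^-distribʳ-* q (suc (r j)) (suc i) ⟨
      (suc (r j) ℕ.* suc i) ℕ.^ q                 ∎)
      where open ℕ.≤-Reasoning

    r-close : ∀ i j → frac (r i) i ℚ.- frac (r j) j ℚ.≤ frac 1 j
    r-close i j = begin
      x ℚ.- y            ≤⟨ ℚ.+-monoˡ-≤ (ℚ.- y) (frac-mono {r i} {suc (r j)} i j (ℕ.<⇒≤ (r-cross i j))) ⟩
      frac (suc (r j)) j ℚ.- y     ≡⟨ cong (ℚ._- y) (frac-suc (r j) j) ⟩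
      y ℚ.+ frac 1 j ℚ.- y         ≡⟨ x+y-x y (frac 1 j) ⟩
      frac 1 j                     ∎
      where
      open ℚ.≤-Reasoning
      x = frac (r i) i
      y = frac (r j) j

    r-cauchy : IsCauchy (λ j → frac (r j) j)
    r-cauchy ε 0<ε with archimedean ε 0<ε
    ... | N , h = N , λ i j N≤i N≤j → ∣x-y∣<ε (frac (r i) i) (frac (r j) j)
      (ℚ.≤-<-trans (r-close i j) (h j N≤j))
      (ℚ.≤-<-trans (r-close j i) (h i N≤i))

root : (q : ℕ) .{{_ : ℕ.NonZero q}} → ℕ → ℝ
root q b = mkℝ (λ j → + rootNumerator q b j ℚ./ suc j) (r-cauchy q b)

-- m^(p/q), for a natural number m
_^[_/_] : ℕ → (p q : ℕ) .{{_ : ℕ.NonZero q}} → ℝ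
m ^[ p / q ] = root q (m ℕ.^ p)

2≤n⇒n∸1≢0 : ∀ {n} → 2 ℕ.≤ n → ℕ.NonZero (n ℕ.∸ 1)
2≤n⇒n∸1≢0 (ℕ.s≤s (ℕ.s≤s _)) = _

module _ (S : Setoid a ℓ) where
  open Setoid S using (Carrier)

  subsetoid : Pred Carrier p → Setoid (a ⊔ p) ℓ
  subsetoid P = On.setoid {B = ∃ P} S proj₁

  HasCardinality : Pred Carrier p → ℕ → Set (a ⊔ ℓ ⊔ p)
  HasCardinality P m = Bijection (≡-setoid (Fin m)) (subsetoid P)

  -- The number of elements of a subset need not be computable even when it is
  -- bounded, so an upper bound says that it bounds the size of every finite
  -- family of distinct elements; classically, the subset is then finite.
  CardinalityAtMost : Pred Carrier p → ℝ → Set (a ⊔ ℓ ⊔ p)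
  CardinalityAtMost P c =
    ∀ k → Injection (≡-setoid (Fin k)) (subsetoid P) → fromℕ k ≤ c

Point : ℕ → Set
Point n = Vector ℝ n

open VectorEquality ℝ-setoid public using (_≋_) renaming (≋-setoid to Point-setoid)

0ᵖ : ∀ {n} → Point n
0ᵖ _ = 0ℝ

LinearlyIndependent : ∀ {n k} → (Fin k → Point n) → Set
LinearlyIndependent {n} {k} v =
  (c : Fin k → ℝ) → (λ j → sum (λ i → c i * v i j)) ≋ 0ᵖ → ∀ i → c i ≈ 0ℝ

record Line (n : ℕ) : Set where
  field
    base        : Point n
    direction   : Point n
    direction≉0 : ¬ (direction ≋ 0ᵖ)

open Line public

infix 4 _∈ˡ_ _≈ˡ_

_∈ˡ_ : ∀ {n} → Point n → Line n → Set
x ∈ˡ l = ∃[ t ] (x ≋ (λ j → base l j + t * direction l j))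

-- Lines are equal as sets of points: one line has many bases and directions.
_≈ˡ_ : ∀ {n} → Line n → Line n → Set
l ≈ˡ l′ = ∀ x → x ∈ˡ l ⇔ x ∈ˡ l′

Line-setoid : ℕ → Setoid 0ℓ 0ℓ
Line-setoid n = record
  { Carrier       = Line n
  ; _≈_           = _≈ˡ_
  ; isEquivalence = record
    { refl  = λ x → mk⇔ (λ h → h) (λ h → h)
    ; sym   = λ e x → mk⇔ (from (e x)) (to (e x))
    ; trans = λ e f x → mk⇔ (λ h → to (f x) (to (e x) h)) (λ h → from (e x) (from (f x) h))
    }
  }
  where open Equivalence

IsJoint : ∀ {n} → Pred (Line n) 0ℓ → Pred (Point n) 0ℓ
IsJoint {n} L x = Σ[ l ∈ (Fin n → Line n) ]
  ( (∀ i → L (l i))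
  × (∀ i → x ∈ˡ l i)
  × LinearlyIndependent (λ i → direction (l i)))

{-# OPTIONS --safe #-}
module Submission where

open import Algebra.Bundles using (CommutativeRing)
import Algebra.Properties.Ring as RingProperties
import Algebra.Properties.Semiring.Mult as SemiringMult
import Algebra.Properties.Semiring.Sum as SemiringSum
import Algebra.Solver.Ring.NaturalCoefficients.Default as SemiringSolver
open import Data.Fin.Base using (Fin; zero; suc; punchIn; punchOut; splitAt; _↑ˡ_; _↑ʳ_)
open import Data.Fin.Properties
  using (punchIn-punchOut; splitAt⁻¹-↑ˡ; splitAt⁻¹-↑ʳ; splitAt-↑ˡ; splitAt-↑ʳ)
  renaming (_≟_ to _≟ᶠ_)
open import Data.Integer.Base as ℤ using (+_)
import Data.Integer.Properties as ℤ
open import Data.List.Base using (List; []; _∷_; length; map; filter; allFin)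
open import Data.List.Membership.Propositional using (_∈_; find; lose)
open import Data.List.Membership.Propositional.Properties using (∈-filter⁺; ∈-filter⁻; ∈-allFin)
open import Data.List.Properties using (filter-all; filter-notAll; length-tabulate)
open import Data.List.Relation.Unary.All as All using ()
open import Data.List.Relation.Unary.AllPairs using ([]; _∷_)
open import Data.List.Relation.Unary.Any as Any using (Any; any?; here; there)
open import Data.List.Relation.Unary.Unique.Propositional using (Unique)
open import Data.List.Relation.Unary.Unique.Propositional.Properties using (filter⁺; allFin⁺)
open import Data.Nat.Base as ℕ using (ℕ; zero; suc; z≤n; s≤s; _∸_)
import Data.Nat.Properties as ℕ
import Data.Nat.Solver as ℕSolver
open import Data.Product.Base using (_×_; _,_; ∃-syntax; proj₁; proj₂)
open import Data.Rational.Base as ℚ using (ℚ; 0ℚ; 1ℚ; ½; ∣_∣)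
import Data.Rational.Properties as ℚ
import Data.Rational.Solver as ℚSolver
import Data.Rational.Unnormalised.Base as ℚᵘ
import Data.Rational.Unnormalised.Properties as ℚᵘ
open import Data.Sum.Base using (_⊎_; inj₁; inj₂; [_,_]′)
open import Data.Unit.Base using (⊤)
open import Data.Vec.Functional using (Vector; head; tail; insertAt; _++_)
open import Data.Vec.Functional.Properties using (insertAt-lookup; insertAt-punchIn)
open import Function.Base using (_∘_)
open import Function.Bundles using (Bijection; Injection; Equivalence)
open import Level using (0ℓ)
open import Relation.Binary.Bundles using (Setoid)
open import Relation.Binary.Definitions using (_Respects_)
open import Relation.Binary.PropositionalEquality as ≡ using (_≡_; _≢_)
open import Relation.Nullary using (¬_; Dec; yes; no; contradiction)
open import Relation.Nullary.Decidable using (¬?; decidable-stable; ¬¬-excluded-middle)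
open import Relation.Nullary.Negation using (DoubleNegation)
open import Relation.Unary using (Pred)

-- Let M ^ n > k, so that some nonzero polynomial p of degree < M in each
-- variable vanishes at the k joints. If every line contained more than n M of
-- the joints, p and then, inductively, all its iterated derivatives would
-- vanish at all joints: a polynomial vanishing at the joints vanishes on all
-- lines, so its gradient at a joint is orthogonal to n independent directions.
-- Hence p would be zero. So some line contains at most n M joints; removing it
-- together with these joints and iterating gives k ≤ m n M, and M ≈ k^(1/n).
--
-- The resulting inequality is between natural numbers, hence decidable, which
-- is why the classical steps over the reals may be taken under a double
-- negation.

-- Counting in filtered lists

length-removed : ∀ {k} (x : Fin k) {xs} → Unique xs →
                 length xs ℕ.≤ suc (length (filter (λ y → ¬? (y ≟ᶠ x)) xs))
length-removed x []                        = z≤n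
length-removed x {y ∷ xs} (y∉xs ∷ xs!) with y ≟ᶠ x
... | no _       = s≤s (length-removed x xs!)
... | yes ≡.refl = s≤s (ℕ.≤-reflexive (≡.cong length (≡.sym
  (filter-all (λ z → ¬? (z ≟ᶠ x)) (All.map (λ x≢z z≡x → x≢z (≡.sym z≡x)) y∉xs)))))

length-filter-split : ∀ {A : Set} {P : A → Set} (P? : ∀ x → Dec (P x)) xs →
  length xs ≡ length (filter P? xs) ℕ.+ length (filter (λ x → ¬? (P? x)) xs)
length-filter-split P? []       = ≡.refl
length-filter-split P? (x ∷ xs) with P? x
... | yes _ = ≡.cong suc (length-filter-split P? xs)
... | no  _ = ≡.trans (≡.cong suc (length-filter-split P? xs)) (≡.sym (ℕ.+-suc _ _))

-- Domains of characteristic zero with stable equality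

record CharZeroDomain : Set₁ where
  field
    commutativeRing : CommutativeRing 0ℓ 0ℓ

  open CommutativeRing commutativeRing public hiding (zero; distrib)
  open SemiringMult semiring public using () renaming (_×_ to _·_)

  field
    -- Suited to constructive reals, whose equality is undecidable: stability permits classical case
    -- splits, and cancellation takes the place of division by an element known only to be not zero.
    ≈-stable  : ∀ {x y} → ¬ ¬ x ≈ y → x ≈ y
    x*y≈0⇒y≈0 : ∀ {x y} → ¬ x ≈ 0# → x * y ≈ 0# → y ≈ 0#
    1+n·1≉0   : ∀ n → ¬ suc n · 1# ≈ 0#

module OverDomain (D : CharZeroDomain) where

  open CharZeroDomain D
  open SemiringMult semiring using (×-congʳ; ×-assoc-*)
  open SemiringSum semiring
    using (sum; sum-cong-≋; sum-remove; sum-replicate-zero; ∑-distrib-+; ∑-comm; *-distribˡ-sum; *-distribʳ-sum)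
  open RingProperties ring using (+-cancelʳ)
  open import Relation.Binary.Reasoning.Setoid setoid
  open SemiringSolver commutativeSemiring using (solve; _:=_; _:+_; _:*_)

  private variable
    n k d : ℕ

  Vec : ℕ → Set
  Vec = Vector Carrier

  1≉0 : ¬ 1# ≈ 0#
  1≉0 1≈0 = 1+n·1≉0 0 (trans (+-identityʳ 1#) 1≈0)

  1+n·x≈0⇒x≈0 : ∀ n {x} → suc n · x ≈ 0# → x ≈ 0#
  1+n·x≈0⇒x≈0 n {x} eq = x*y≈0⇒y≈0 (1+n·1≉0 n) (begin
    suc n · 1# * x     ≈⟨ ×-assoc-* (suc n) 1# x ⟩
    suc n · (1# * x)   ≈⟨ ×-congʳ (suc n) (*-identityˡ x) ⟩
    suc n · x          ≈⟨ eq ⟩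
    0#                 ∎)

  s*x≈t*x⇒x≈0 : ∀ {s t x} → ¬ s ≈ t → s * x ≈ t * x → x ≈ 0#
  s*x≈t*x⇒x≈0 {s} {t} {x} s≉t eq = x*y≈0⇒y≈0 s-t≉0 (begin
    (s - t) * x        ≈⟨ distribʳ x s (- t) ⟩
    s * x + - t * x    ≈⟨ +-congʳ eq ⟩
    t * x + - t * x    ≈⟨ distribʳ x t (- t) ⟨
    (t - t) * x        ≈⟨ *-congʳ (-‿inverseʳ t) ⟩
    0# * x             ≈⟨ zeroˡ x ⟩
    0#                 ∎)
    where
    s-t≉0 : ¬ s - t ≈ 0#
    s-t≉0 eq′ = s≉t (+-cancelʳ (- t) s t (trans eq′ (sym (-‿inverseʳ t))))

  xy-yx≈0 : ∀ x y → x * y + - y * x ≈ 0#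
  xy-yx≈0 x y = begin
    x * y + - y * x   ≈⟨ +-congˡ (*-comm (- y) x) ⟩
    x * y + x * - y   ≈⟨ distribˡ x y (- y) ⟨
    x * (y - y)       ≈⟨ *-congˡ (-‿inverseʳ y) ⟩
    x * 0#            ≈⟨ zeroʳ x ⟩
    0#                ∎

  sum-zero : {f : Vec n} → (∀ i → f i ≈ 0#) → sum f ≈ 0#
  sum-zero {n} f≈0 = trans (sum-cong-≋ f≈0) (sum-replicate-zero n)

  sum-splitAt : ∀ m (f : Vec (m ℕ.+ n)) → sum f ≈ sum (f ∘ (_↑ˡ n)) + sum (f ∘ (m ↑ʳ_))
  sum-splitAt zero    f = sym (+-identityˡ _)
  sum-splitAt (suc m) f = trans (+-congˡ (sum-splitAt m (f ∘ suc))) (sym (+-assoc _ _ _))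

  -- Linear algebra over the domain

  infix 7 _∙_
  _∙_ : Vec n → Vec n → Carrier
  u ∙ v = sum (λ i → u i * v i)

  -- If the second alternative is refuted, no entry is nonzero, and stability makes each one zero.
  zeroOrNonzero : (u : Vec n) → DoubleNegation ((∀ i → u i ≈ 0#) ⊎ ∃[ i ] ¬ u i ≈ 0#)
  zeroOrNonzero u h = h (inj₁ λ i → ≈-stable λ u≉0 → h (inj₂ (i , u≉0)))

  -- Fraction-free Gaussian elimination, by induction on the number of equations: a pivot in the
  -- first equation removes that equation and one unknown.
  homogeneousSolution : k ℕ.< n → (A : Fin k → Vec n) →
    DoubleNegation (∃[ c ] ((∃[ j ] ¬ c j ≈ 0#) × ∀ i → A i ∙ c ≈ 0#))
  homogeneousSolution {zero}  {suc n} _ A h = h ((λ _ → 1#) , (zero , 1≉0) , λ ())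
  homogeneousSolution {suc k} {suc n} (s≤s k<n) A h = zeroOrNonzero (A zero) λ where
    (inj₁ A₀≈0) → homogeneousSolution (ℕ.m<n⇒m<1+n k<n) (A ∘ suc) λ where
      (c , c≉0 , A∙c≈0) → h (c , c≉0 , λ where
        zero    → sum-zero λ j → trans (*-congʳ (A₀≈0 j)) (zeroˡ (c j))
        (suc i) → A∙c≈0 i)
    (inj₂ (p , a≉0)) →
      let
        a = A zero p
        eliminate : Vec (suc n) → Vec n
        -- The row `a R - R p A₀`, which is zero in column `p`, with that column left out.
        eliminate R j = a * R (punchIn p j) + - A zero (punchIn p j) * R p
      in homogeneousSolution k<n (eliminate ∘ A ∘ suc) λ where
        (c , (j , cj≉0) , E∙c≈0) →
          let
            -- Off `p` the solution is scaled by the pivot `a`, so that the entry `S` at `p` solves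
            -- the first equation without a division.
            S  = sum (λ j → - A zero (punchIn p j) * c j)
            c′ = insertAt (λ j → a * c j) p S
            c′-p : c′ p ≡ S
            c′-p = insertAt-lookup (λ j → a * c j) p S
            c′-punchIn : ∀ j → c′ (punchIn p j) ≡ a * c j
            c′-punchIn = insertAt-punchIn (λ j → a * c j) p S
            R∙c′ : ∀ R → R ∙ c′ ≈ eliminate R ∙ c
            R∙c′ R = begin
              R ∙ c′
                ≈⟨ sum-remove {i = p} (λ j → R j * c′ j) ⟩
              R p * c′ p + sum (λ j → R (punchIn p j) * c′ (punchIn p j))
                ≈⟨ +-cong (*-congˡ (reflexive c′-p)) (sum-cong-≋ λ j → *-congˡ (reflexive (c′-punchIn j))) ⟩
              R p * S + sum (λ j → R (punchIn p j) * (a * c j))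
                ≈⟨ +-congʳ (*-distribˡ-sum (R p) (λ j → - A zero (punchIn p j) * c j)) ⟩
              sum (λ j → R p * (- A zero (punchIn p j) * c j)) + sum (λ j → R (punchIn p j) * (a * c j))
                ≈⟨ ∑-distrib-+ (λ j → R p * (- A zero (punchIn p j) * c j)) (λ j → R (punchIn p j) * (a * c j)) ⟨
              sum (λ j → R p * (- A zero (punchIn p j) * c j) + R (punchIn p j) * (a * c j))
                ≈⟨ sum-cong-≋ (λ j → solve 5 (λ r b c s a → r :* (b :* c) :+ s :* (a :* c) := (a :* s :+ b :* r) :* c) refl
                     (R p) (- A zero (punchIn p j)) (c j) (R (punchIn p j)) a) ⟩
              eliminate R ∙ c ∎
          in h (c′ ,
            (punchIn p j , λ c′≈0 → cj≉0 (x*y≈0⇒y≈0 a≉0 (trans (reflexive (≡.sym (c′-punchIn j))) c′≈0))) ,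
            λ where
              zero    → trans (R∙c′ (A zero)) (sum-zero λ j → trans (*-congʳ (xy-yx≈0 a (A zero (punchIn p j)))) (zeroˡ (c j)))
              (suc i) → trans (R∙c′ (A (suc i))) (E∙c≈0 i))

  Independent : (Fin k → Vec n) → Set
  Independent {k} v = ∀ (c : Vec k) → (∀ j → sum (λ i → c i * v i j) ≈ 0#) → ∀ i → c i ≈ 0#

  -- If g p ≠ 0, some nontrivial combination of the n rows vanishes outside the
  -- column p, and then also in the column p because it is orthogonal to g.
  independent-⊥ : (v : Fin n → Vec n) → Independent v →
                  ∀ g → (∀ i → v i ∙ g ≈ 0#) → ∀ p → g p ≈ 0#
  independent-⊥ {suc n} v indep g v∙g≈0 p = ≈-stable λ gp≉0 →
    homogeneousSolution (ℕ.n<1+n n) (λ j i → v i (punchIn p j)) λ where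
      (c , (i , ci≉0) , eqs) → ci≉0 (indep c (combination≈0 gp≉0 c eqs) i)
    where
    combination≈0 : ¬ g p ≈ 0# → ∀ c → (∀ j → (λ i → v i (punchIn p j)) ∙ c ≈ 0#) →
                    ∀ j → sum (λ i → c i * v i j) ≈ 0#
    combination≈0 gp≉0 c eqs = w≈0
      where
      w : Vec (suc n)
      w j = sum (λ i → c i * v i j)
      w-punchIn : ∀ j → w (punchIn p j) ≈ 0#
      w-punchIn j = trans (sum-cong-≋ λ i → *-comm (c i) (v i (punchIn p j))) (eqs j)
      w∙g≈0 : w ∙ g ≈ 0#
      w∙g≈0 = begin
        sum (λ j → w j * g j)
          ≈⟨ sum-cong-≋ (λ j → trans (*-distribʳ-sum (g j) (λ i → c i * v i j)) (sum-cong-≋ λ i → *-assoc (c i) (v i j) (g j))) ⟩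
        sum (λ j → sum (λ i → c i * (v i j * g j)))
          ≈⟨ ∑-comm (λ j i → c i * (v i j * g j)) ⟩
        sum (λ i → sum (λ j → c i * (v i j * g j)))
          ≈⟨ sum-zero (λ i → trans (sym (*-distribˡ-sum (c i) (λ j → v i j * g j))) (trans (*-congˡ (v∙g≈0 i)) (zeroʳ (c i)))) ⟩
        0# ∎
      gp*wp≈0 : g p * w p ≈ 0#
      gp*wp≈0 = begin
        g p * w p           ≈⟨ *-comm (g p) (w p) ⟩
        w p * g p           ≈⟨ +-identityʳ _ ⟨
        w p * g p + 0#      ≈⟨ +-congˡ (sum-zero λ j → trans (*-congʳ (w-punchIn j)) (zeroˡ (g (punchIn p j)))) ⟨
        w p * g p + sum (λ j → w (punchIn p j) * g (punchIn p j))   ≈⟨ sum-remove {i = p} (λ j → w j * g j) ⟨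
        w ∙ g               ≈⟨ w∙g≈0 ⟩
        0#                  ∎
      w≈0 : ∀ j → w j ≈ 0#
      w≈0 j with p ≟ᶠ j
      ... | yes ≡.refl = x*y≈0⇒y≈0 gp≉0 gp*wp≈0
      ... | no p≢j = trans (reflexive (≡.cong w (≡.sym (punchIn-punchOut p≢j)))) (w-punchIn (punchOut p≢j))

  -- Univariate polynomial functions

  -- f has degree < d as a polynomial function; the difference quotient of f at
  -- s is the g in f t − f s = (t − s) g t, with both sides moved so that no
  -- subtraction occurs.
  DegreeBelow : ℕ → (Carrier → Carrier) → Set
  DegreeBelow zero    f = ∀ t → f t ≈ 0#
  DegreeBelow (suc d) f = ∀ s → ∃[ g ] (DegreeBelow d g × ∀ t → f t + s * g t ≈ f s + t * g t)

  DegreeBelow-suc : ∀ {f} → DegreeBelow d f → DegreeBelow (suc d) f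
  DegreeBelow-suc {zero} f≈0 s = (λ _ → 0#) , (λ _ → refl) , λ t →
    +-cong (trans (f≈0 t) (sym (f≈0 s))) (trans (zeroʳ s) (sym (zeroʳ t)))
  DegreeBelow-suc {suc d} f-deg s with f-deg s
  ... | g , g-deg , eq = g , DegreeBelow-suc g-deg , eq

  DegreeBelow-≤ : ∀ {d e f} → d ℕ.≤ e → DegreeBelow d f → DegreeBelow e f
  DegreeBelow-≤ {d} {e} {f} d≤e f-deg = go (ℕ.≤⇒≤′ d≤e)
    where
    go : ∀ {e} → d ℕ.≤′ e → DegreeBelow e f
    go (ℕ.≤′-reflexive ≡.refl) = f-deg
    go (ℕ.≤′-step d≤e)         = DegreeBelow-suc (go d≤e)

  DegreeBelow-0 : ∀ d → DegreeBelow d (λ _ → 0#)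
  DegreeBelow-0 d = DegreeBelow-≤ {0} {d} z≤n (λ _ → refl)

  DegreeBelow-const : ∀ c → DegreeBelow (suc d) (λ _ → c)
  DegreeBelow-const {d} c s = (λ _ → 0#) , DegreeBelow-0 d , λ t →
    +-congˡ (trans (zeroʳ s) (sym (zeroʳ t)))

  DegreeBelow-+ : ∀ {f g} → DegreeBelow d f → DegreeBelow d g → DegreeBelow d (λ t → f t + g t)
  DegreeBelow-+ {zero} f≈0 g≈0 t = trans (+-cong (f≈0 t) (g≈0 t)) (+-identityˡ 0#)
  DegreeBelow-+ {suc d} {f} {g} f-deg g-deg s with f-deg s | g-deg s
  ... | f′ , f′-deg , f-eq | g′ , g′-deg , g-eq = (λ t → f′ t + g′ t) , DegreeBelow-+ f′-deg g′-deg , λ t → begin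
    f t + g t + s * (f′ t + g′ t)            ≈⟨ rearrange (f t) (g t) s (f′ t) (g′ t) ⟩
    (f t + s * f′ t) + (g t + s * g′ t)      ≈⟨ +-cong (f-eq t) (g-eq t) ⟩
    (f s + t * f′ t) + (g s + t * g′ t)      ≈⟨ rearrange (f s) (g s) t (f′ t) (g′ t) ⟨
    f s + g s + t * (f′ t + g′ t)            ∎
    where
    rearrange : ∀ a b s c d → a + b + s * (c + d) ≈ (a + s * c) + (b + s * d)
    rearrange = solve 5 (λ a b s c d → a :+ b :+ s :* (c :+ d) := (a :+ s :* c) :+ (b :+ s :* d)) refl

  DegreeBelow-scale : ∀ {f} c → DegreeBelow d f → DegreeBelow d (λ t → c * f t)
  DegreeBelow-scale {zero} c f≈0 t = trans (*-congˡ (f≈0 t)) (zeroʳ c)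
  DegreeBelow-scale {suc d} {f} c f-deg s with f-deg s
  ... | g , g-deg , eq = (λ t → c * g t) , DegreeBelow-scale c g-deg , λ t → begin
    c * f t + s * (c * g t)   ≈⟨ rearrange c (f t) s (g t) ⟩
    c * (f t + s * g t)       ≈⟨ *-congˡ (eq t) ⟩
    c * (f s + t * g t)       ≈⟨ rearrange c (f s) t (g t) ⟨
    c * f s + t * (c * g t)   ∎
    where
    rearrange : ∀ c a s b → c * a + s * (c * b) ≈ c * (a + s * b)
    rearrange = solve 4 (λ c a s b → c :* a :+ s :* (c :* b) := c :* (a :+ s :* b)) refl

  -- The product rule for difference quotients: `(a + t v) f t - (a + s v) f s = (t - s) (v f t + (a
  -- + s v) g t)`.
  DegreeBelow-affine : ∀ {f} a v → DegreeBelow d f → DegreeBelow (suc d) (λ t → (a + t * v) * f t)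
  DegreeBelow-affine {zero} a v f≈0 = DegreeBelow-suc {0} λ t → trans (*-congˡ (f≈0 t)) (zeroʳ (a + t * v))
  DegreeBelow-affine {suc d} {f} a v f-deg s with f-deg s
  ... | g , g-deg , eq = (λ t → v * f t + (a + s * v) * g t) ,
    DegreeBelow-+ {suc d} (DegreeBelow-scale {suc d} v f-deg) (DegreeBelow-suc {d} (DegreeBelow-scale (a + s * v) g-deg)) , λ t → begin
    (a + t * v) * f t + s * (v * f t + (a + s * v) * g t)   ≈⟨ lhs a t v (f t) s (g t) ⟩
    (a + s * v) * (f t + s * g t) + t * (v * f t)           ≈⟨ +-congʳ (*-congˡ (eq t)) ⟩
    (a + s * v) * (f s + t * g t) + t * (v * f t)           ≈⟨ rhs a t v (f t) s (g t) (f s) ⟩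
    (a + s * v) * f s + t * (v * f t + (a + s * v) * g t)   ∎
    where
    lhs : ∀ a t v F s G → (a + t * v) * F + s * (v * F + (a + s * v) * G) ≈ (a + s * v) * (F + s * G) + t * (v * F)
    lhs = solve 6 (λ a t v F s G → (a :+ t :* v) :* F :+ s :* (v :* F :+ (a :+ s :* v) :* G)
                                := (a :+ s :* v) :* (F :+ s :* G) :+ t :* (v :* F)) refl
    rhs : ∀ a t v F s G f → (a + s * v) * (f + t * G) + t * (v * F) ≈ (a + s * v) * f + t * (v * F + (a + s * v) * G)
    rhs = solve 7 (λ a t v F s G f → (a :+ s :* v) :* (f :+ t :* G) :+ t :* (v :* F)
                                  := (a :+ s :* v) :* f :+ t :* (v :* F :+ (a :+ s :* v) :* G)) refl

  -- The difference quotient at the first root has smaller degree and vanishes at the other roots.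
  -- By induction it is zero, so `f` is constant with the value it has at that root. Roots are
  -- listed through labels, which `τ` has to separate only on the list.
  manyRoots⇒≈0 : ∀ {A : Set} {f} → DegreeBelow d f → (τ : A → Carrier) (xs : List A) → Unique xs →
    (∀ {x y} → x ∈ xs → y ∈ xs → τ x ≈ τ y → x ≡ y) →
    (∀ {x} → x ∈ xs → f (τ x) ≈ 0#) → d ℕ.≤ length xs → ∀ t → f t ≈ 0#
  manyRoots⇒≈0 {zero} f≈0 τ xs _ _ _ _ = f≈0
  manyRoots⇒≈0 {suc d} {f = f} f-deg τ (x ∷ xs) (x∉xs ∷ xs!) τ-inj roots (s≤s d≤) t with f-deg (τ x)
  ... | g , g-deg , eq = begin
    f t                ≈⟨ +-identityʳ (f t) ⟨
    f t + 0#           ≈⟨ +-congˡ (trans (*-congˡ (g≈0 t)) (zeroʳ (τ x))) ⟨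
    f t + τ x * g t    ≈⟨ eq t ⟩
    f (τ x) + t * g t  ≈⟨ +-cong (roots (here ≡.refl)) (trans (*-congˡ (g≈0 t)) (zeroʳ t)) ⟩
    0# + 0#            ≈⟨ +-identityʳ 0# ⟩
    0#                 ∎
    where
    g-root : ∀ {y} → y ∈ xs → g (τ y) ≈ 0#
    g-root {y} y∈ = s*x≈t*x⇒x≈0
      (λ τx≈τy → All.lookup x∉xs y∈ (τ-inj (here ≡.refl) (there y∈) τx≈τy))
      (begin
        τ x * g (τ y)              ≈⟨ +-identityˡ _ ⟨
        0# + τ x * g (τ y)         ≈⟨ +-congʳ (roots (there y∈)) ⟨
        f (τ y) + τ x * g (τ y)    ≈⟨ eq (τ y) ⟩
        f (τ x) + τ y * g (τ y)    ≈⟨ +-congʳ (roots (here ≡.refl)) ⟩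
        0# + τ y * g (τ y)         ≈⟨ +-identityˡ _ ⟩
        τ y * g (τ y)              ∎)
    g≈0 : ∀ t → g t ≈ 0#
    g≈0 = manyRoots⇒≈0 g-deg τ xs xs! (λ x∈ y∈ → τ-inj (there x∈) (there y∈)) g-root d≤

  -- Polynomials in n variables

  -- p ▹ q stands for p + x₀ q, where x₀ does not occur in p.
  infixr 5 _▹_
  data Poly : ℕ → Set where
    con : Carrier → Poly 0
    nil : Poly (suc n)
    _▹_ : Poly n → Poly (suc n) → Poly (suc n)

  eval : Poly n → Vec n → Carrier
  eval (con c) a = c
  eval nil     a = 0#
  eval (p ▹ q) a = eval p (tail a) + head a * eval q a

  scale : ℕ → Poly n → Poly n
  scale k (con c) = con (k · c)
  scale k nil     = nil
  scale k (p ▹ q) = scale k p ▹ scale k q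

  -- Multiplies the coefficient of x₀ʲ by k + j.
  weighted : ℕ → Poly (suc n) → Poly (suc n)
  weighted k nil     = nil
  weighted k (p ▹ q) = scale k p ▹ weighted (suc k) q

  ∂ : Fin n → Poly n → Poly n
  ∂ i       nil     = nil
  ∂ zero    (p ▹ q) = weighted 1 q
  ∂ (suc i) (p ▹ q) = ∂ i p ▹ ∂ (suc i) q

  ∂* : List (Fin n) → Poly n → Poly n
  ∂* []      p = p
  ∂* (i ∷ w) p = ∂* w (∂ i p)

  -- Only an upper bound for the total degree: p ▹ nil has degree at least 1.
  degree : Poly n → ℕ
  degree (con c) = 0
  degree nil     = 0
  degree (p ▹ q) = degree p ℕ.⊔ suc (degree q)

  degree-scale : ∀ k (p : Poly n) → degree (scale k p) ≡ degree p
  degree-scale k (con c) = ≡.refl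
  degree-scale k nil     = ≡.refl
  degree-scale k (p ▹ q) = ≡.cong₂ (λ d e → d ℕ.⊔ suc e) (degree-scale k p) (degree-scale k q)

  degree-weighted : ∀ k (p : Poly (suc n)) → degree (weighted k p) ≡ degree p
  degree-weighted k nil     = ≡.refl
  degree-weighted k (p ▹ q) = ≡.cong₂ (λ d e → d ℕ.⊔ suc e) (degree-scale k p) (degree-weighted (suc k) q)

  degree-∂ : ∀ i (p : Poly n) → degree (∂ i p) ℕ.≤ degree p
  degree-∂ i       nil     = ℕ.≤-refl
  degree-∂ zero    (p ▹ q) = ℕ.≤-trans (ℕ.≤-reflexive (degree-weighted 1 q))
    (ℕ.≤-trans (ℕ.n≤1+n (degree q)) (ℕ.m≤n⊔m (degree p) (suc (degree q))))
  degree-∂ (suc i) (p ▹ q) = ℕ.⊔-mono-≤ (degree-∂ i p) (s≤s (degree-∂ (suc i) q))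

  eval-scale : ∀ k (p : Poly n) a → eval (scale k p) a ≈ k · eval p a
  eval-scale k (con c) a = refl
  eval-scale zero    nil a = refl
  eval-scale (suc k) nil a = trans (eval-scale k nil a) (sym (+-identityˡ _))
  eval-scale k (p ▹ q) a = trans
    (+-cong (eval-scale k p (tail a)) (*-congˡ (eval-scale k q a)))
    (collect k (eval p (tail a)) (head a) (eval q a))
    where
    collect : ∀ k x y z → k · x + y * (k · z) ≈ k · (x + y * z)
    collect zero    x y z = trans (+-identityˡ _) (zeroʳ y)
    collect (suc k) x y z = trans
      (solve 5 (λ x u y z v → x :+ u :+ y :* (z :+ v) := x :+ y :* z :+ (u :+ y :* v)) refl x (k · x) y z (k · z))
      (+-congˡ (collect k x y z))

  -- Coefficientwise this is `suc k + j = 1 + (k + j)`.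
  eval-weighted-suc : ∀ k (p : Poly (suc n)) a →
    eval (weighted (suc k) p) a ≈ eval p a + eval (weighted k p) a
  eval-weighted-suc k nil     a = sym (+-identityˡ 0#)
  eval-weighted-suc k (p ▹ q) a = begin
    eval (scale (suc k) p) a′ + a₀ * eval (weighted (suc (suc k)) q) a
      ≈⟨ +-cong (eval-scale (suc k) p a′) (*-congˡ (eval-weighted-suc (suc k) q a)) ⟩
    eval p a′ + k · eval p a′ + a₀ * (eval q a + eval (weighted (suc k) q) a)
      ≈⟨ solve 5 (λ x u y z v → x :+ u :+ y :* (z :+ v) := x :+ y :* z :+ (u :+ y :* v)) refl
           (eval p a′) (k · eval p a′) a₀ (eval q a) (eval (weighted (suc k) q) a) ⟩
    eval p a′ + a₀ * eval q a + (k · eval p a′ + a₀ * eval (weighted (suc k) q) a)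
      ≈⟨ +-congˡ (+-congʳ (eval-scale k p a′)) ⟨
    eval p a′ + a₀ * eval q a + (eval (scale k p) a′ + a₀ * eval (weighted (suc k) q) a) ∎
    where
    a′ = tail a
    a₀ = head a

  -- The product rule for `x₀ q`; `p` is constant in `x₀`.
  eval-∂-zero : ∀ (p : Poly n) q a → eval (∂ zero (p ▹ q)) a ≈ eval q a + head a * eval (∂ zero q) a
  eval-∂-zero p q a = trans (eval-weighted-suc 0 q a) (+-congˡ (weighted-0 q))
    where
    -- `weighted 0` is the Euler operator `x₀ ∂/∂x₀`.
    weighted-0 : ∀ q → eval (weighted 0 q) a ≈ head a * eval (∂ zero q) a
    weighted-0 nil      = sym (zeroʳ (head a))
    weighted-0 (p ▹ q)  = trans (+-congʳ (eval-scale 0 p (tail a))) (+-identityˡ _)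

  line : Vec n → Vec n → Carrier → Vec n
  line a v t i = a i + t * v i

  eval-cong : ∀ (p : Poly n) {a b} → (∀ i → a i ≈ b i) → eval p a ≈ eval p b
  eval-cong (con c) a≈b = refl
  eval-cong nil     a≈b = refl
  eval-cong (p ▹ q) a≈b = +-cong (eval-cong p (a≈b ∘ suc)) (*-cong (a≈b zero) (eval-cong q a≈b))

  gradient : Poly n → Vec n → Vec n
  gradient p a i = eval (∂ i p) a

  -- The difference quotient at `0` of `p` along the line, as a polynomial function. Its value at
  -- `0` is the directional derivative, and `degree p` distinct roots are enough to make it zero.
  record LineExpansion (p : Poly n) (a v : Vec n) : Set where
    field
      remainder   : Carrier → Carrier
      degreeBelow : DegreeBelow (degree p) remainder
      expansion   : ∀ t → eval p (line a v t) ≈ eval p a + t * remainder t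
      derivative  : remainder 0# ≈ v ∙ gradient p a

  open LineExpansion

  lineExpansion : (p : Poly n) → ∀ a v → LineExpansion p a v
  lineExpansion (con c) a v = record
    { remainder   = λ _ → 0#
    ; degreeBelow = λ _ → refl
    ; expansion   = λ t → sym (trans (+-congˡ (zeroʳ t)) (+-identityʳ c))
    ; derivative  = refl
    }
  lineExpansion nil a v = record
    { remainder   = λ _ → 0#
    ; degreeBelow = λ _ → refl
    ; expansion   = λ t → sym (trans (+-congˡ (zeroʳ t)) (+-identityʳ 0#))
    ; derivative  = sym (sum-zero λ i → zeroʳ (v i))
    }
  lineExpansion {suc n} (p ▹ q) a v = record
    -- What multiplies `t` once both expansions are inserted into `p + (a₀ + t v₀) q`.
    { remainder   = λ t → g t + v₀ * eval q a + (a₀ + t * v₀) * h t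
    ; degreeBelow = DegreeBelow-+ {e}
        (DegreeBelow-+ {e}
          (DegreeBelow-≤ {degree p} (ℕ.m≤m⊔n (degree p) (suc (degree q))) (degreeBelow P))
          (DegreeBelow-≤ {suc (degree q)} (ℕ.m≤n⊔m (degree p) (suc (degree q))) (DegreeBelow-const {degree q} (v₀ * eval q a))))
        (DegreeBelow-≤ {suc (degree q)} (ℕ.m≤n⊔m (degree p) (suc (degree q)))
          (DegreeBelow-affine {degree q} a₀ v₀ (degreeBelow Q)))
    ; expansion   = λ t → trans
        (+-cong (expansion P t) (*-congˡ (expansion Q t)))
        (solve 7 (λ x y a₀ v₀ t g h →
            (x :+ t :* g) :+ (a₀ :+ t :* v₀) :* (y :+ t :* h)
            := x :+ a₀ :* y :+ t :* (g :+ v₀ :* y :+ (a₀ :+ t :* v₀) :* h))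
          refl (eval p a′) (eval q a) a₀ v₀ t (g t) (h t))
    ; derivative  = begin
        g 0# + v₀ * eval q a + (a₀ + 0# * v₀) * h 0#
          ≈⟨ +-cong (+-congʳ (derivative P)) (*-cong (trans (+-congˡ (zeroˡ v₀)) (+-identityʳ a₀)) (derivative Q)) ⟩
        v′ ∙ gradient p a′ + v₀ * eval q a + a₀ * (v₀ * q₀ + v′ ∙ q′)
          ≈⟨ solve 6 (λ x v₀ y a₀ q₀ z →
                 x :+ v₀ :* y :+ a₀ :* (v₀ :* q₀ :+ z)
                 := v₀ :* (y :+ a₀ :* q₀) :+ (x :+ a₀ :* z))
               refl (v′ ∙ gradient p a′) v₀ (eval q a) a₀ q₀ (v′ ∙ q′) ⟩
        v₀ * (eval q a + a₀ * q₀) + (v′ ∙ gradient p a′ + a₀ * (v′ ∙ q′))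
          ≈⟨ +-cong (*-congˡ (sym (eval-∂-zero p q a)))
               (+-congˡ (*-distribˡ-sum a₀ (λ i → v′ i * q′ i))) ⟩
        v₀ * gradient (p ▹ q) a zero + (v′ ∙ gradient p a′ + sum (λ i → a₀ * (v′ i * q′ i)))
          ≈⟨ +-congˡ (∑-distrib-+ (λ i → v′ i * gradient p a′ i) (λ i → a₀ * (v′ i * q′ i))) ⟨
        v₀ * gradient (p ▹ q) a zero + sum (λ i → v′ i * gradient p a′ i + a₀ * (v′ i * q′ i))
          ≈⟨ +-congˡ (sum-cong-≋ λ i → solve 4 (λ v x a₀ y → v :* x :+ a₀ :* (v :* y) := v :* (x :+ a₀ :* y)) refl
               (v′ i) (gradient p a′ i) a₀ (q′ i)) ⟩
        v ∙ gradient (p ▹ q) a ∎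
    }
    where
    a₀ = head a
    v₀ = head v
    a′ = tail a
    v′ = tail v
    P  = lineExpansion p a′ v′
    Q  = lineExpansion q a v
    g  = remainder P
    h  = remainder Q
    e  = degree (p ▹ q)
    q₀ = gradient q a zero
    q′ : Vec n
    q′ i = gradient q a (suc i)

  IsZero : Poly n → Set
  IsZero (con c) = c ≈ 0#
  IsZero nil     = ⊤
  IsZero (p ▹ q) = IsZero p × IsZero q

  eval-IsZero : (p : Poly n) → IsZero p → ∀ a → eval p a ≈ 0#
  eval-IsZero (con c) c≈0         a = c≈0
  eval-IsZero nil     _           a = refl
  eval-IsZero (p ▹ q) (p≈0 , q≈0) a = trans
    (+-cong (eval-IsZero p p≈0 (tail a)) (trans (*-congˡ (eval-IsZero q q≈0 a)) (zeroʳ (head a))))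
    (+-identityˡ 0#)

  IsZero-scale : ∀ k (p : Poly n) → IsZero p → IsZero (scale k p)
  IsZero-scale zero    (con c) c≈0     = refl
  IsZero-scale (suc k) (con c) c≈0     = trans (+-cong c≈0 (IsZero-scale k (con c) c≈0)) (+-identityˡ 0#)
  IsZero-scale k       nil     _       = _
  IsZero-scale k (p ▹ q) (p≈0 , q≈0)   = IsZero-scale k p p≈0 , IsZero-scale k q q≈0

  IsZero-weighted : ∀ k (p : Poly (suc n)) → IsZero p → IsZero (weighted k p)
  IsZero-weighted k nil     _           = _
  IsZero-weighted k (p ▹ q) (p≈0 , q≈0) = IsZero-scale k p p≈0 , IsZero-weighted (suc k) q q≈0

  IsZero-∂ : ∀ i (p : Poly n) → IsZero p → IsZero (∂ i p)
  IsZero-∂ i       nil     _           = _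
  IsZero-∂ zero    (p ▹ q) (_ , q≈0)   = IsZero-weighted 1 q q≈0
  IsZero-∂ (suc i) (p ▹ q) (p≈0 , q≈0) = IsZero-∂ i p p≈0 , IsZero-∂ (suc i) q q≈0

  IsZero-∂* : ∀ w (p : Poly n) → IsZero p → IsZero (∂* w p)
  IsZero-∂* []      p p≈0 = p≈0
  IsZero-∂* (i ∷ w) p p≈0 = IsZero-∂* w (∂ i p) (IsZero-∂ i p p≈0)

  -- Characteristic zero enters here: the positive factor `suc k` is cancelled from every
  -- coefficient.
  IsZero-scale⁻ : ∀ k (p : Poly n) → IsZero (scale (suc k) p) → IsZero p
  IsZero-scale⁻ k (con c) kc≈0        = 1+n·x≈0⇒x≈0 k kc≈0
  IsZero-scale⁻ k nil     _           = _
  IsZero-scale⁻ k (p ▹ q) (p≈0 , q≈0) = IsZero-scale⁻ k p p≈0 , IsZero-scale⁻ k q q≈0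

  IsZero-weighted⁻ : ∀ k (p : Poly (suc n)) → IsZero (weighted (suc k) p) → IsZero p
  IsZero-weighted⁻ k nil     _           = _
  IsZero-weighted⁻ k (p ▹ q) (p≈0 , q≈0) = IsZero-scale⁻ k p p≈0 , IsZero-weighted⁻ (suc k) q q≈0

  length₀ : Poly (suc n) → ℕ
  length₀ nil     = 0
  length₀ (p ▹ q) = suc (length₀ q)

  length₀-weighted : ∀ k (p : Poly (suc n)) → length₀ (weighted k p) ≡ length₀ p
  length₀-weighted k nil     = ≡.refl
  length₀-weighted k (p ▹ q) = ≡.cong suc (length₀-weighted (suc k) q)

  -- Derivatives in the other variables treat `x₀` as a constant.
  ∂*-map-suc : ∀ w (p : Poly n) q → ∂* (map suc w) (p ▹ q) ≡ ∂* w p ▹ ∂* (map suc w) q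
  ∂*-map-suc []      p q = ≡.refl
  ∂*-map-suc (i ∷ w) p q = ∂*-map-suc w (∂ i p) (∂ (suc i) q)

  -- Taylor coefficients at one point determine a polynomial. The `x₀`-derivative of `p ▹ q` is
  -- `weighted 1 q`, which vanishes by the inner induction; cancelling the weights gives `q = 0`.
  -- The derivatives in the other variables then see only `p`, which vanishes by induction on the
  -- number of variables.
  derivatives≈0⇒IsZero : (p : Poly n) → ∀ a → (∀ w → eval (∂* w p) a ≈ 0#) → IsZero p
  derivatives≈0⇒IsZero {zero}  (con c) a D≈0 = D≈0 []
  derivatives≈0⇒IsZero {suc n} p a D≈0 = go (length₀ p) p ≡.refl D≈0
    where
    -- The induction runs on the number of coefficients in `x₀`, since `weighted 1 q` is not a
    -- subterm of `p ▹ q`.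
    go : ∀ ℓ (p : Poly (suc n)) → length₀ p ≡ ℓ → (∀ w → eval (∂* w p) a ≈ 0#) → IsZero p
    go ℓ       nil     _  _   = _
    go (suc ℓ) (p ▹ q) eq D≈0 = p≈0 , q≈0
      where
      q≈0 : IsZero q
      q≈0 = IsZero-weighted⁻ 0 q (go ℓ (weighted 1 q)
        (≡.trans (length₀-weighted 1 q) (ℕ.suc-injective eq)) (λ w → D≈0 (zero ∷ w)))
      p≈0 : IsZero p
      p≈0 = derivatives≈0⇒IsZero p (tail a) λ w → begin
        eval (∂* w p) (tail a)
          ≈⟨ +-identityʳ _ ⟨
        eval (∂* w p) (tail a) + 0#
          ≈⟨ +-congˡ (trans (*-congˡ (eval-IsZero (∂* (map suc w) q) (IsZero-∂* (map suc w) q q≈0) a)) (zeroʳ (head a))) ⟨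
        eval (∂* w p ▹ ∂* (map suc w) q) a
          ≡⟨ ≡.cong (λ r → eval r a) (∂*-map-suc w p q) ⟨
        eval (∂* (map suc w) (p ▹ q)) a
          ≈⟨ D≈0 (map suc w) ⟩
        0# ∎

  -- Nonzero polynomials vanishing at given points

  module _ (M : ℕ) where

    -- The coefficient vector is cut into blocks of length `M ^ n`, one for each power of the new
    -- variable; `fromRows` allows any number `ℓ` of blocks so that it can recurse.
    fromCoefficients : (n : ℕ) → Vec (M ℕ.^ n) → Poly n
    fromRows : (n ℓ : ℕ) → Vec (ℓ ℕ.* M ℕ.^ n) → Poly (suc n)

    fromCoefficients zero    c = con (c zero)
    fromCoefficients (suc n) c = fromRows n M c

    fromRows n zero    c = nil
    fromRows n (suc ℓ) c = fromCoefficients n (c ∘ (_↑ˡ ℓ ℕ.* M ℕ.^ n)) ▹ fromRows n ℓ (c ∘ (M ℕ.^ n ↑ʳ_))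

    -- Listed in the order of the coefficients, so that evaluation at `a` is a dot product and
    -- vanishing there is a linear equation.
    monomials : (n : ℕ) → Vec n → Vec (M ℕ.^ n)
    monomialRows : (n ℓ : ℕ) → Vec (suc n) → Vec (ℓ ℕ.* M ℕ.^ n)

    monomials zero    a _ = 1#
    monomials (suc n) a   = monomialRows n M a

    monomialRows n zero    a ()
    monomialRows n (suc ℓ) a = monomials n (tail a) ++ (λ j → head a * monomialRows n ℓ a j)

    eval-fromCoefficients : ∀ n c a → eval (fromCoefficients n c) a ≈ monomials n a ∙ c
    eval-fromRows : ∀ n ℓ c a → eval (fromRows n ℓ c) a ≈ monomialRows n ℓ a ∙ c

    eval-fromCoefficients zero    c a = sym (trans (+-identityʳ _) (*-identityˡ (c zero)))
    eval-fromCoefficients (suc n) c a = eval-fromRows n M c a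

    eval-fromRows n zero    c a = refl
    eval-fromRows n (suc ℓ) c a = begin
      eval (fromCoefficients n (c ∘ (_↑ˡ _))) (tail a) + head a * eval (fromRows n ℓ (c ∘ (K ↑ʳ_))) a
        ≈⟨ +-cong (eval-fromCoefficients n _ (tail a)) (*-congˡ (eval-fromRows n ℓ _ a)) ⟩
      xs ∙ (c ∘ (_↑ˡ _)) + head a * (monomialRows n ℓ a ∙ (c ∘ (K ↑ʳ_)))
        ≈⟨ +-congˡ (*-distribˡ-sum (head a) (λ j → monomialRows n ℓ a j * c (K ↑ʳ j))) ⟩
      xs ∙ (c ∘ (_↑ˡ _)) + sum (λ j → head a * (monomialRows n ℓ a j * c (K ↑ʳ j)))
        ≈⟨ +-cong
             (sum-cong-≋ λ i → *-congʳ (reflexive (≡.cong [ xs , ys ]′ (≡.sym (splitAt-↑ˡ K i (ℓ ℕ.* K))))))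
             (sum-cong-≋ λ j → trans (sym (*-assoc _ _ _))
               (*-congʳ (reflexive (≡.cong [ xs , ys ]′ (≡.sym (splitAt-↑ʳ K (ℓ ℕ.* K) j)))))) ⟩
      sum (λ i → (xs ++ ys) (i ↑ˡ ℓ ℕ.* K) * c (i ↑ˡ ℓ ℕ.* K)) + sum (λ j → (xs ++ ys) (K ↑ʳ j) * c (K ↑ʳ j))
        ≈⟨ sum-splitAt K (λ j → (xs ++ ys) j * c j) ⟨
      (xs ++ ys) ∙ c ∎
      where
      K  = M ℕ.^ n
      xs = monomials n (tail a)
      ys : Vec (ℓ ℕ.* K)
      ys j = head a * monomialRows n ℓ a j

    IsZero-fromCoefficients : ∀ n c → IsZero (fromCoefficients n c) → ∀ j → c j ≈ 0#
    IsZero-fromRows : ∀ n ℓ c → IsZero (fromRows n ℓ c) → ∀ j → c j ≈ 0#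

    IsZero-fromCoefficients zero    c c≈0 zero = c≈0
    IsZero-fromCoefficients (suc n) c = IsZero-fromRows n M c

    IsZero-fromRows n (suc ℓ) c (p≈0 , q≈0) j with splitAt (M ℕ.^ n) j in eq
    ... | inj₁ i = trans (reflexive (≡.cong c (≡.sym (splitAt⁻¹-↑ˡ eq)))) (IsZero-fromCoefficients n _ p≈0 i)
    ... | inj₂ i = trans (reflexive (≡.cong c (≡.sym (splitAt⁻¹-↑ʳ {M ℕ.^ n} eq)))) (IsZero-fromRows n ℓ _ q≈0 i)

    -- The bound is `n * M` and not `n * (M - 1)`, because `degree` also counts the `▹` before the
    -- closing `nil`.
    degree-fromCoefficients : ∀ n c → degree (fromCoefficients n c) ℕ.≤ n ℕ.* M
    degree-fromRows : ∀ n ℓ c → degree (fromRows n ℓ c) ℕ.≤ ℓ ℕ.+ n ℕ.* M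

    degree-fromCoefficients zero    c = z≤n
    degree-fromCoefficients (suc n) c = degree-fromRows n M c

    degree-fromRows n zero    c = z≤n
    degree-fromRows n (suc ℓ) c = ℕ.⊔-lub
      (ℕ.≤-trans (degree-fromCoefficients n _) (ℕ.m≤n+m (n ℕ.* M) (suc ℓ)))
      (s≤s (degree-fromRows n ℓ _))

    -- Parameter counting: `k` linear equations in `M ^ n` unknown coefficients.
    vanishingPolynomial : ∀ {k} → k ℕ.< M ℕ.^ n → (x : Fin k → Vec n) →
      DoubleNegation (∃[ p ] (degree p ℕ.≤ n ℕ.* M × ¬ IsZero p × ∀ i → eval p (x i) ≈ 0#))
    vanishingPolynomial {n} k< x h = homogeneousSolution k< (monomials n ∘ x) λ where
      (c , (j , cj≉0) , eqs) → h (fromCoefficients n c , degree-fromCoefficients n c ,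
        (λ p≈0 → cj≉0 (IsZero-fromCoefficients n c p≈0 j)) ,
        λ i → trans (eval-fromCoefficients n c (x i)) (eqs i))

  -- Joints and lines over a domain

  parameter-difference : ∀ {b v s s′ x x′} → x ≈ b + s * v → x′ ≈ b + s′ * v → x′ ≈ x + (s′ - s) * v
  parameter-difference {b} {v} {s} {s′} {x} {x′} x≈ x′≈ = begin
    x′                                ≈⟨ x′≈ ⟩
    b + s′ * v                        ≈⟨ +-congʳ (+-identityʳ b) ⟨
    b + 0# + s′ * v                   ≈⟨ +-congʳ (+-congˡ (trans (*-congʳ (-‿inverseʳ s)) (zeroˡ v))) ⟨
    b + (s - s) * v + s′ * v          ≈⟨ solve 5 (λ b s r s′ v → b :+ (s :+ r) :* v :+ s′ :* v := b :+ s :* v :+ (s′ :+ r) :* v)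
                                           refl b s (- s) s′ v ⟩
    b + s * v + (s′ - s) * v          ≈⟨ +-congʳ x≈ ⟨
    x + (s′ - s) * v                  ∎

  -- Lines are bare indices with an abstract incidence relation, not assumed decidable. Directions
  -- belong to a joint together with one of its chosen lines, so two joints may use different
  -- direction vectors for the same line.
  record JointsConfiguration (n m k : ℕ) : Set₁ where
    field
      joint       : Fin k → Vec n
      joint-inj   : ∀ i j → (∀ r → joint i r ≈ joint j r) → i ≡ j
      _on_        : Fin k → Fin m → Set
      through     : Fin k → Fin n → Fin m
      on-through  : ∀ j i → j on through j i
      direction   : Fin k → Fin n → Vec n
      independent : ∀ j → Independent (direction j)
      parameter   : ∀ j i j′ → j′ on through j i →
                    ∃[ t ] (∀ r → joint j′ r ≈ line (joint j) (direction j i) t r)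

  module _ {n m k : ℕ} (𝒥 : JointsConfiguration n m k) where
    open JointsConfiguration 𝒥

    module _ (on? : ∀ l j → Dec (j on l)) where

      joints : Fin m → List (Fin k) → List (Fin k)
      joints l = filter (on? l)

      module _ {d : ℕ} {ls : List (Fin m)} {js : List (Fin k)} (js! : Unique js)
               (through∈ls : ∀ {j} → j ∈ js → ∀ i → through j i ∈ ls)
               (rich : ∀ {l} → l ∈ ls → d ℕ.< length (joints l js)) where

        -- On each chosen line through a joint, the remainder of `p` vanishes at the at least `d`
        -- other joints and has degree below `d`, so it is zero. Its value at `0` makes the gradient
        -- orthogonal to the direction, and the `n` directions are independent.
        ∂-vanishes : (p : Poly n) → degree p ℕ.≤ d → (∀ {j} → j ∈ js → eval p (joint j) ≈ 0#) →
                     ∀ i {j} → j ∈ js → eval (∂ i p) (joint j) ≈ 0#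
        ∂-vanishes p p≤d p≈0 i {j} j∈js =
          independent-⊥ (direction j) (independent j) (gradient p (joint j)) orthogonal i
          where
          orthogonal : ∀ i → direction j i ∙ gradient p (joint j) ≈ 0#
          orthogonal i = trans (sym (derivative E)) (manyRoots⇒≈0 (degreeBelow E) τ xs xs!
            (λ x∈ y∈ → τ-inj (on-xs x∈) (on-xs y∈)) root (ℕ.≤-trans p≤d d≤) 0#)
            where
            l = through j i
            E = lineExpansion p (joint j) (direction j i)
            xs = filter (λ j′ → ¬? (j′ ≟ᶠ j)) (joints l js)

            xs! : Unique xs
            xs! = filter⁺ (λ j′ → ¬? (j′ ≟ᶠ j)) (filter⁺ (on? l) js!)

            d≤ : d ℕ.≤ length xs
            -- The strict inequality in `rich` pays for leaving out `j` itself, whose parameter `0`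
            -- cannot be cancelled.
            d≤ = ℕ.s≤s⁻¹ (ℕ.≤-trans (rich (through∈ls j∈js i)) (length-removed j (filter⁺ (on? l) js!)))

            xs⊆ : ∀ {j′} → j′ ∈ xs → (j′ ∈ js × j′ on l) × j′ ≢ j
            xs⊆ j′∈xs with ∈-filter⁻ (λ j′ → ¬? (j′ ≟ᶠ j)) {xs = joints l js} j′∈xs
            ... | j′∈ , j′≢j = ∈-filter⁻ (on? l) {xs = js} j′∈ , j′≢j

            on-xs : ∀ {j′} → j′ ∈ xs → j′ on l
            on-xs j′∈xs = proj₂ (proj₁ (xs⊆ j′∈xs))

            τ : Fin k → Carrier
            τ j′ with on? l j′
            ... | yes j′∈l = proj₁ (parameter j i j′ j′∈l)
            -- A default for joints off the line; the members of `xs` all lie on it.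
            ... | no  _    = 0#

            joint-τ : ∀ {j′} → j′ on l → ∀ r → joint j′ r ≈ line (joint j) (direction j i) (τ j′) r
            joint-τ {j′} on-l with on? l j′
            ... | yes j′∈l = proj₂ (parameter j i j′ j′∈l)
            ... | no  j′∉l = contradiction on-l j′∉l

            τ-inj : ∀ {x y} → x on l → y on l → τ x ≈ τ y → x ≡ y
            τ-inj x-on y-on τx≈τy = joint-inj _ _ λ r →
              trans (joint-τ x-on r) (trans (+-congˡ (*-congʳ τx≈τy)) (sym (joint-τ y-on r)))

            τ≉0 : ∀ {j′} → j′ on l → j′ ≢ j → ¬ τ j′ ≈ 0#
            τ≉0 on-l j′≢j τ≈0 = j′≢j (joint-inj _ _ λ r → trans (joint-τ on-l r)
              (trans (+-congˡ (trans (*-congʳ τ≈0) (zeroˡ _))) (+-identityʳ _)))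

            root : ∀ {j′} → j′ ∈ xs → remainder E (τ j′) ≈ 0#
            root {j′} j′∈xs with xs⊆ j′∈xs
            -- Both joints are zeros of `p`, so the expansion reduces to `τ j′` times the remainder,
            -- and `τ j′` is nonzero.
            ... | (j′∈js , on-l) , j′≢j = x*y≈0⇒y≈0 (τ≉0 on-l j′≢j) (begin
              τ j′ * remainder E (τ j′)                       ≈⟨ +-identityˡ _ ⟨
              0# + τ j′ * remainder E (τ j′)                  ≈⟨ +-congʳ (p≈0 j∈js) ⟨
              eval p (joint j) + τ j′ * remainder E (τ j′)    ≈⟨ expansion E (τ j′) ⟨
              eval p (line (joint j) (direction j i) (τ j′))  ≈⟨ eval-cong p (joint-τ on-l) ⟨
              eval p (joint j′)                               ≈⟨ p≈0 j′∈js ⟩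
              0#                                              ∎)

        -- The degree bound does not grow under `∂ i`, so `∂-vanishes` can be iterated with the same
        -- `d`.
        ∂*-vanishes : ∀ w (p : Poly n) → degree p ℕ.≤ d → (∀ {j} → j ∈ js → eval p (joint j) ≈ 0#) →
                      ∀ {j} → j ∈ js → eval (∂* w p) (joint j) ≈ 0#
        ∂*-vanishes []      p p≤d p≈0 = p≈0
        ∂*-vanishes (i ∷ w) p p≤d p≈0 = ∂*-vanishes w (∂ i p)
          (ℕ.≤-trans (degree-∂ i p) p≤d) (∂-vanishes p p≤d p≈0 i)

      module _ (p : Poly n) (p≉0 : ¬ IsZero p) (p-vanishes : ∀ j → eval p (joint j) ≈ 0#) where

        -- Otherwise all iterated derivatives of `p` would vanish at the joint `j`, forcing `p` to
        -- be zero. The search through a finite list is decidable, so this contradiction produces a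
        -- line.
        poorLine : ∀ {ls js j} → Unique js → (∀ {j} → j ∈ js → ∀ i → through j i ∈ ls) → j ∈ js →
                   Any (λ l → length (joints l js) ℕ.≤ degree p) ls
        poorLine {ls} {js} {j} js! through∈ls j∈js =
          decidable-stable (any? (λ l → length (joints l js) ℕ.≤? degree p) ls) λ noPoor →
            p≉0 (derivatives≈0⇒IsZero p (joint j) λ w →
              ∂*-vanishes js! through∈ls (λ l∈ls → ℕ.≰⇒> λ poor → noPoor (lose l∈ls poor))
                w p ℕ.≤-refl (λ {j} _ → p-vanishes j) j∈js)

        -- Induction on the number of lines: a poor line is removed together with its at most
        -- `degree p` joints, and the remaining joints keep all their lines.
        #joints≤#lines*degree : Fin n → ∀ s {ls js} → length ls ℕ.≤ s → Unique js →
          (∀ {j} → j ∈ js → ∀ i → through j i ∈ ls) → length js ℕ.≤ s ℕ.* degree p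
        #joints≤#lines*degree i₀ s       {js = []}     _  _   _ = z≤n
        -- The index `i₀` witnesses positive dimension: a remaining joint would have a line in the
        -- empty list.
        #joints≤#lines*degree i₀ zero    {[]}  {j ∷ _} _  _   through∈ls with through∈ls (here ≡.refl) i₀
        ... | ()
        #joints≤#lines*degree i₀ (suc s) {ls} {js@(_ ∷ _)} ls≤ js! through∈ls
          with find (poorLine js! through∈ls (here ≡.refl))
        ... | l , l∈ls , poor = ℕ.≤-trans (ℕ.≤-reflexive (length-filter-split (on? l) js))
            (ℕ.+-mono-≤ poor (#joints≤#lines*degree i₀ s {ls′} {js′} ls′≤ js′! through∈ls′))
            where
            ls′ = filter (λ l′ → ¬? (l′ ≟ᶠ l)) ls
            js′ = filter (λ j → ¬? (on? l j)) js
            js′! : Unique js′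
            js′! = filter⁺ (λ j → ¬? (on? l j)) js!
            ls′≤ : length ls′ ℕ.≤ s
            ls′≤ = ℕ.s≤s⁻¹ (ℕ.≤-trans
              (filter-notAll (λ l′ → ¬? (l′ ≟ᶠ l)) ls (Any.map (λ l≡l′ l′≢l → l′≢l (≡.sym l≡l′)) l∈ls)) ls≤)
            through∈ls′ : ∀ {j} → j ∈ js′ → ∀ i → through j i ∈ ls′
            through∈ls′ {j} j∈js′ i with ∈-filter⁻ (λ j → ¬? (on? l j)) {xs = js} j∈js′
            -- A joint kept in `js′` is off `l`, so none of its chosen lines is `l`.
            ... | j∈js , j∉l = ∈-filter⁺ (λ l′ → ¬? (l′ ≟ᶠ l)) (through∈ls j∈js i)
              λ eq → j∉l (≡.subst (j on_) eq (on-through j i))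

  -- Finitely many choices can be collected one after another. Used over lines and joints, this
  -- decides all incidences at once.
  ¬¬-Π : ∀ {n} {P : Fin n → Set} → (∀ i → DoubleNegation (P i)) → DoubleNegation (∀ i → P i)
  ¬¬-Π {zero}  ps h = h λ ()
  ¬¬-Π {suc n} ps h = ps zero λ p → ¬¬-Π (ps ∘ suc) λ ps′ → h λ where
    zero    → p
    (suc i) → ps′ i

  #joints≤ : ∀ {n m k} → JointsConfiguration (suc n) m k → ∀ M → k ℕ.< M ℕ.^ suc n →
             k ℕ.≤ m ℕ.* (suc n ℕ.* M)
  #joints≤ {n} {m} {k} 𝒥 M k< = decidable-stable (k ℕ.≤? m ℕ.* (suc n ℕ.* M)) λ k≰ →
    ¬¬-Π {P = λ l → ∀ j → Dec (j on l)} (λ l → ¬¬-Π λ j → ¬¬-excluded-middle) λ on? →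
    vanishingPolynomial M k< joint λ where
      (p , p≤ , p≉0 , p-vanishes) → k≰ (ℕ.≤-trans
        (ℕ.≤-reflexive (≡.sym (length-tabulate {n = k} (λ j → j))))
        (ℕ.≤-trans
          (#joints≤#lines*degree 𝒥 on? p p≉0 p-vanishes zero m {allFin m} {allFin k}
            (ℕ.≤-reflexive (length-tabulate {n = m} (λ l → l))) (allFin⁺ k) (λ {j} _ i → ∈-allFin (through j i)))
          (ℕ.*-monoʳ-≤ m p≤)))
    where open JointsConfiguration 𝒥

open import Defs

-- The reals as a domain

private variable
  u v : ℕ → ℚ

-- `x ≈ y` unfolds to `Null` of the difference of the two sequences.
Null : (ℕ → ℚ) → Set
Null u = ∀ ε → 0ℚ ℚ.< ε → ∃[ N ] (∀ i → N ℕ.≤ i → ∣ u i ∣ ℚ.< ε)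

AwayFrom0 : (ℕ → ℚ) → Set
AwayFrom0 u = ∃[ δ ] (0ℚ ℚ.< δ × ∃[ N ] (∀ i → N ℕ.≤ i → δ ℚ.≤ ∣ u i ∣))

Bounded : (ℕ → ℚ) → Set
Bounded u = ∃[ B ] (0ℚ ℚ.< B × ∃[ N ] (∀ i → N ℕ.≤ i → ∣ u i ∣ ℚ.≤ B))

0<½*ε : ∀ {ε} → 0ℚ ℚ.< ε → 0ℚ ℚ.< ½ ℚ.* ε
0<½*ε 0<ε = ℚ.*-monoʳ-<-pos ½ 0<ε

½*ε+½*ε : ∀ ε → ½ ℚ.* ε ℚ.+ ½ ℚ.* ε ≡ ε
½*ε+½*ε ε = ≡.trans (≡.sym (ℚ.*-distribʳ-+ ε ½ ½)) (ℚ.*-identityˡ ε)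

Null-resp : (∀ i → u i ≡ v i) → Null u → Null v
Null-resp u≗v u-null ε 0<ε with u-null ε 0<ε
... | N , h = N , λ i N≤i → ≡.subst (λ q → ∣ q ∣ ℚ.< ε) (u≗v i) (h i N≤i)

Null-0 : Null (λ _ → 0ℚ)
Null-0 ε 0<ε = 0 , λ _ _ → 0<ε

Null-neg : Null u → Null (λ i → ℚ.- u i)
Null-neg {u} u-null ε 0<ε with u-null ε 0<ε
... | N , h = N , λ i N≤i → ≡.subst (ℚ._< ε) (≡.sym (ℚ.∣-p∣≡∣p∣ (u i))) (h i N≤i)

Null-+ : Null u → Null v → Null (λ i → u i ℚ.+ v i)
Null-+ {u} {v} u-null v-null ε 0<ε with u-null (½ ℚ.* ε) (0<½*ε 0<ε) | v-null (½ ℚ.* ε) (0<½*ε 0<ε)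
... | M , f | N , g = M ℕ.⊔ N , λ i le → ℚ.≤-<-trans (ℚ.∣p+q∣≤∣p∣+∣q∣ (u i) (v i))
  (≡.subst (_ ℚ.<_) (½*ε+½*ε ε) (ℚ.+-mono-< (f i (ℕ.m⊔n≤o⇒m≤o M N le)) (g i (ℕ.m⊔n≤o⇒n≤o M N le))))

Null-* : Bounded u → Null v → Null (λ i → u i ℚ.* v i)
Null-* {u} {v} (B , 0<B , M , f) v-null ε 0<ε = M ℕ.⊔ N , λ i le → begin-strict
  ∣ u i ℚ.* v i ∣      ≡⟨ ℚ.∣p*q∣≡∣p∣*∣q∣ (u i) (v i) ⟩
  ∣ u i ∣ ℚ.* ∣ v i ∣  ≤⟨ ℚ.*-monoʳ-≤-nonNeg ∣ v i ∣ {{ℚ.∣-∣-nonNeg (v i)}} (f i (ℕ.m⊔n≤o⇒m≤o M N le)) ⟩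
  B ℚ.* ∣ v i ∣        <⟨ ℚ.*-monoʳ-<-pos B {{B-pos}} (g i (ℕ.m⊔n≤o⇒n≤o M N le)) ⟩
  B ℚ.* δ              ≡⟨ ℚ.*-assoc B B⁻¹ ε ⟨
  B ℚ.* B⁻¹ ℚ.* ε      ≡⟨ ≡.cong (ℚ._* ε) (ℚ.*-inverseʳ B {{B-nz}}) ⟩
  1ℚ ℚ.* ε             ≡⟨ ℚ.*-identityˡ ε ⟩
  ε                    ∎
  where
  open ℚ.≤-Reasoning
  B-pos = ℚ.positive 0<B
  B-nz  = ℚ.pos⇒nonZero B {{B-pos}}
  B⁻¹   = (ℚ.1/ B) {{B-nz}}
  δ     = B⁻¹ ℚ.* ε
  0<δ : 0ℚ ℚ.< δ
  0<δ = ≡.subst (ℚ._< δ) (ℚ.*-zeroʳ B⁻¹) (ℚ.*-monoʳ-<-pos B⁻¹ {{ℚ.1/pos⇒pos B {{B-pos}}}} 0<ε)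
  N = proj₁ (v-null δ 0<δ)
  g = proj₂ (v-null δ 0<δ)

seq-bounded : ∀ x → Bounded (seq x)
seq-bounded x with cauchy x 1ℚ (ℚ.positive⁻¹ 1ℚ)
... | N , h = 1ℚ ℚ.+ ∣ xN ∣ , ℚ.+-mono-<-≤ (ℚ.positive⁻¹ 1ℚ) (ℚ.0≤∣p∣ xN) , N , λ i N≤i → begin
  ∣ seq x i ∣                       ≡⟨ ≡.cong ∣_∣ (solve 2 (λ p q → p := (p :- q) :+ q) ≡.refl (seq x i) xN) ⟩
  ∣ (seq x i ℚ.- xN) ℚ.+ xN ∣       ≤⟨ ℚ.∣p+q∣≤∣p∣+∣q∣ (seq x i ℚ.- xN) xN ⟩
  ∣ seq x i ℚ.- xN ∣ ℚ.+ ∣ xN ∣     ≤⟨ ℚ.+-monoˡ-≤ ∣ xN ∣ (ℚ.<⇒≤ (h i N N≤i ℕ.≤-refl)) ⟩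
  1ℚ ℚ.+ ∣ xN ∣                     ∎
  where
  open ℚ.≤-Reasoning
  open ℚSolver.+-*-Solver
  xN = seq x N

-- The dichotomy is decided by comparing a late enough term with ε / 2.
eventuallySmallOrAwayFrom0 : IsCauchy u → ∀ ε → 0ℚ ℚ.< ε →
  ∃[ N ] (∀ i → N ℕ.≤ i → ∣ u i ∣ ℚ.< ε) ⊎ AwayFrom0 u
eventuallySmallOrAwayFrom0 {u} u-cauchy ε 0<ε with u-cauchy q 0<q
  where
  -- A quarter of `ε`: terms from `N` on differ by less than `q`, so they stay below `ε` if
  -- `∣ u N ∣` is below `ε / 2`, and otherwise at least `ε / 2 - q = q`.
  q = ½ ℚ.* (½ ℚ.* ε)
  0<q = 0<½*ε (0<½*ε 0<ε)
... | N , h with ∣ u N ∣ ℚ.<? ½ ℚ.* ε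
...   | yes uN< = inj₁ (N , λ i N≤i → begin-strict
  ∣ u i ∣                        ≡⟨ ≡.cong ∣_∣ (solve 2 (λ p q → p := (p :- q) :+ q) ≡.refl (u i) (u N)) ⟩
  ∣ (u i ℚ.- u N) ℚ.+ u N ∣      ≤⟨ ℚ.∣p+q∣≤∣p∣+∣q∣ (u i ℚ.- u N) (u N) ⟩
  ∣ u i ℚ.- u N ∣ ℚ.+ ∣ u N ∣    <⟨ ℚ.+-mono-< (ℚ.<-trans (h i N N≤i ℕ.≤-refl) q<) uN< ⟩
  ½ ℚ.* ε ℚ.+ ½ ℚ.* ε            ≡⟨ ½*ε+½*ε ε ⟩
  ε                              ∎)
  where
  open ℚ.≤-Reasoning
  open ℚSolver.+-*-Solver
  q = ½ ℚ.* (½ ℚ.* ε)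
  0<q : 0ℚ ℚ.< q
  0<q = 0<½*ε (0<½*ε 0<ε)
  q< : q ℚ.< ½ ℚ.* ε
  q< = ≡.subst₂ ℚ._<_ (ℚ.+-identityʳ q) (½*ε+½*ε (½ ℚ.* ε)) (ℚ.+-monoʳ-< q 0<q)
...   | no uN≮ = inj₂ (q , 0<½*ε (0<½*ε 0<ε) , N , λ i N≤i → begin
  q                                      ≡⟨ solve 1 (λ q → q := (q :+ q) :- q) ≡.refl q ⟩
  (q ℚ.+ q) ℚ.- q                        ≡⟨ ≡.cong (ℚ._- q) (½*ε+½*ε (½ ℚ.* ε)) ⟩
  ½ ℚ.* ε ℚ.- q                          ≤⟨ ℚ.+-monoˡ-≤ (ℚ.- q) (ℚ.≮⇒≥ uN≮) ⟩
  ∣ u N ∣ ℚ.- q                          ≡⟨ ≡.cong (λ w → ∣ w ∣ ℚ.- q) (solve 2 (λ p q → p := (p :- q) :+ q) ≡.refl (u N) (u i)) ⟩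
  ∣ (u N ℚ.- u i) ℚ.+ u i ∣ ℚ.- q        ≤⟨ ℚ.+-monoˡ-≤ (ℚ.- q) (ℚ.∣p+q∣≤∣p∣+∣q∣ (u N ℚ.- u i) (u i)) ⟩
  ∣ u N ℚ.- u i ∣ ℚ.+ ∣ u i ∣ ℚ.- q      ≤⟨ ℚ.+-monoˡ-≤ (ℚ.- q) (ℚ.+-monoˡ-≤ ∣ u i ∣ (ℚ.<⇒≤ (h N i ℕ.≤-refl N≤i))) ⟩
  q ℚ.+ ∣ u i ∣ ℚ.- q                    ≡⟨ solve 2 (λ q w → q :+ w :- q := w) ≡.refl q ∣ u i ∣ ⟩
  ∣ u i ∣                                ∎)
  where
  open ℚ.≤-Reasoning
  open ℚSolver.+-*-Solver
  q = ½ ℚ.* (½ ℚ.* ε)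

AwayFrom0⇒¬Null : AwayFrom0 u → ¬ Null u
AwayFrom0⇒¬Null (δ , 0<δ , M , f) u-null with u-null δ 0<δ
... | N , g = ℚ.<-irrefl ≡.refl (ℚ.≤-<-trans (f (M ℕ.⊔ N) (ℕ.m≤m⊔n M N)) (g (M ℕ.⊔ N) (ℕ.m≤n⊔m M N)))

-- For each `ε` the dichotomy gives either the required smallness or `AwayFrom0 u`, which `¬¬null`
-- refutes.
Null-stable : IsCauchy u → ¬ ¬ Null u → Null u
Null-stable u-cauchy ¬¬null ε 0<ε with eventuallySmallOrAwayFrom0 u-cauchy ε 0<ε
... | inj₁ small = small
... | inj₂ away  = contradiction (AwayFrom0⇒¬Null away) ¬¬null

-- If `u` is not away from `0`, the dichotomy leaves only smallness, for every `ε`.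
¬Null⇒¬¬AwayFrom0 : IsCauchy u → ¬ Null u → ¬ ¬ AwayFrom0 u
¬Null⇒¬¬AwayFrom0 u-cauchy ¬null ¬away = ¬null λ ε 0<ε →
  [ (λ small → small) , (λ away → contradiction away ¬away) ]′ (eventuallySmallOrAwayFrom0 u-cauchy ε 0<ε)

-- Where `δ ≤ ∣ u i ∣`, a product smaller than `δ ε` forces `∣ v i ∣ < ε`.
AwayFrom0-cancel : AwayFrom0 u → Null (λ i → u i ℚ.* v i) → Null v
AwayFrom0-cancel {u} {v} (δ , 0<δ , M , f) uv-null ε 0<ε with uv-null (δ ℚ.* ε) 0<δε
  where
  0<δε : 0ℚ ℚ.< δ ℚ.* ε
  0<δε = ≡.subst (ℚ._< δ ℚ.* ε) (ℚ.*-zeroʳ δ) (ℚ.*-monoʳ-<-pos δ {{ℚ.positive 0<δ}} 0<ε)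
... | N , g = M ℕ.⊔ N , λ i le → ℚ.*-cancelˡ-<-nonNeg δ {{ℚ.nonNegative (ℚ.<⇒≤ 0<δ)}} (begin-strict
  δ ℚ.* ∣ v i ∣         ≤⟨ ℚ.*-monoʳ-≤-nonNeg ∣ v i ∣ {{ℚ.∣-∣-nonNeg (v i)}} (f i (ℕ.m⊔n≤o⇒m≤o M N le)) ⟩
  ∣ u i ∣ ℚ.* ∣ v i ∣   ≡⟨ ℚ.∣p*q∣≡∣p∣*∣q∣ (u i) (v i) ⟨
  ∣ u i ℚ.* v i ∣       <⟨ g i (ℕ.m⊔n≤o⇒n≤o M N le) ⟩
  δ ℚ.* ε               ∎)
  where open ℚ.≤-Reasoning

infix 8 -ᴿ_
-ᴿ_ : ℝ → ℝ
-ᴿ x = mkℝ (λ i → ℚ.- seq x i) λ ε 0<ε →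
  let N , h = cauchy x ε 0<ε
  in N , λ i j N≤i N≤j → ≡.subst (λ q → ∣ q ∣ ℚ.< ε)
    (solve 2 (λ p q → q :- p := (:- p) :- (:- q)) ≡.refl (seq x i) (seq x j)) (h j i N≤j N≤i)
  where open ℚSolver.+-*-Solver

≗⇒≈ : ∀ x y → (∀ i → seq x i ≡ seq y i) → x ≈ y
≗⇒≈ x y x≗y = Null-resp (λ i → ≡.sym (≡.trans (≡.cong (ℚ._- seq y i) (x≗y i)) (ℚ.+-inverseʳ (seq y i)))) Null-0

ℝ-commutativeRing : CommutativeRing 0ℓ 0ℓ
ℝ-commutativeRing = record
  { Carrier = ℝ ; _≈_ = _≈_ ; _+_ = _+_ ; _*_ = _*_ ; -_ = -ᴿ_ ; 0# = 0ℝ ; 1# = 1ℝ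
  ; isCommutativeRing = record
    { isRing = record
      { +-isAbelianGroup = record
        { isGroup = record
          { isMonoid = record
            { isSemigroup = record
              { isMagma = record
                { isEquivalence = Setoid.isEquivalence ℝ-setoid
                ; ∙-cong = λ {x} {x′} {y} {y′} x≈x′ y≈y′ → Null-resp
                    (λ i → solve 4 (λ x x′ y y′ → (x :- x′) :+ (y :- y′) := (x :+ y) :- (x′ :+ y′)) ≡.refl
                      (seq x i) (seq x′ i) (seq y i) (seq y′ i))
                    (Null-+ x≈x′ y≈y′)
                }
              ; assoc = λ x y z → ≗⇒≈ (x + y + z) (x + (y + z)) λ i → ℚ.+-assoc (seq x i) (seq y i) (seq z i)
              }
            ; identity = (λ x → ≗⇒≈ (0ℝ + x) x λ i → ℚ.+-identityˡ (seq x i))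
                       , (λ x → ≗⇒≈ (x + 0ℝ) x λ i → ℚ.+-identityʳ (seq x i))
            }
          ; inverse = (λ x → ≗⇒≈ (-ᴿ x + x) 0ℝ λ i → ℚ.+-inverseˡ (seq x i))
                    , (λ x → ≗⇒≈ (x + -ᴿ x) 0ℝ λ i → ℚ.+-inverseʳ (seq x i))
          ; ⁻¹-cong = λ {x} {y} x≈y → Null-resp
              (λ i → solve 2 (λ x y → :- (x :- y) := (:- x) :- (:- y)) ≡.refl (seq x i) (seq y i))
              (Null-neg x≈y)
          }
        ; comm = λ x y → ≗⇒≈ (x + y) (y + x) λ i → ℚ.+-comm (seq x i) (seq y i)
        }
      ; *-cong = λ {x} {x′} {y} {y′} x≈x′ y≈y′ → Null-resp
          (λ i → solve 4 (λ x x′ y y′ → y :* (x :- x′) :+ x′ :* (y :- y′) := (x :* y) :- (x′ :* y′)) ≡.refl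
            (seq x i) (seq x′ i) (seq y i) (seq y′ i))
          (Null-+ (Null-* (seq-bounded y) x≈x′) (Null-* (seq-bounded x′) y≈y′))
      ; *-assoc = λ x y z → ≗⇒≈ (x * y * z) (x * (y * z)) λ i → ℚ.*-assoc (seq x i) (seq y i) (seq z i)
      ; *-identity = (λ x → ≗⇒≈ (1ℝ * x) x λ i → ℚ.*-identityˡ (seq x i))
                   , (λ x → ≗⇒≈ (x * 1ℝ) x λ i → ℚ.*-identityʳ (seq x i))
      ; distrib = (λ x y z → ≗⇒≈ (x * (y + z)) (x * y + x * z) λ i → ℚ.*-distribˡ-+ (seq x i) (seq y i) (seq z i))
                , (λ x y z → ≗⇒≈ ((y + z) * x) (y * x + z * x) λ i → ℚ.*-distribʳ-+ (seq x i) (seq y i) (seq z i))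
      }
    ; *-comm = λ x y → ≗⇒≈ (x * y) (y * x) λ i → ℚ.*-comm (seq x i) (seq y i)
    }
  }
  where open ℚSolver.+-*-Solver

open SemiringMult (CommutativeRing.semiring ℝ-commutativeRing) using () renaming (_×_ to _·_)

0≤seq-n·1 : ∀ n i → 0ℚ ℚ.≤ seq (n · 1ℝ) i
0≤seq-n·1 zero    i = ℚ.≤-refl
0≤seq-n·1 (suc n) i = ℚ.+-mono-≤ (ℚ.nonNegative⁻¹ 1ℚ) (0≤seq-n·1 n i)

≈0⇒Null : ∀ x → x ≈ 0ℝ → Null (seq x)
≈0⇒Null x = Null-resp λ i → ℚ.+-identityʳ (seq x i)

Null⇒≈0 : ∀ x → Null (seq x) → x ≈ 0ℝ
Null⇒≈0 x = Null-resp λ i → ≡.sym (ℚ.+-identityʳ (seq x i))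

ℝ-domain : CharZeroDomain
ℝ-domain = record
  { commutativeRing = ℝ-commutativeRing
  ; ≈-stable  = λ {x} {y} → Null-stable (cauchy (x + -ᴿ y))
  -- The goal is stable, so `x` may be taken to be away from `0`.
  ; x*y≈0⇒y≈0 = λ {x} {y} x≉0 xy≈0 → Null⇒≈0 y (Null-stable (cauchy y) λ y-¬null →
      ¬Null⇒¬¬AwayFrom0 (cauchy x) (x≉0 ∘ Null⇒≈0 x) λ x-away →
        y-¬null (AwayFrom0-cancel x-away (≈0⇒Null (x * y) xy≈0)))
  ; 1+n·1≉0   = λ n 1+n≈0 → AwayFrom0⇒¬Null
      (1ℚ , ℚ.positive⁻¹ 1ℚ , 0 , λ i _ → ℚ.≤-trans
        (≡.subst (ℚ._≤ seq (suc n · 1ℝ) i) (ℚ.+-identityʳ 1ℚ) (ℚ.+-monoʳ-≤ 1ℚ (0≤seq-n·1 n i)))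
        (ℚ.≤-reflexive (≡.sym (ℚ.0≤p⇒∣p∣≡p (0≤seq-n·1 (suc n) i)))))
      (≈0⇒Null (suc n · 1ℝ) 1+n≈0)
  }

-- Joints in real space

open OverDomain ℝ-domain using (JointsConfiguration; #joints≤; parameter-difference; Independent)

open SemiringSum (CharZeroDomain.semiring ℝ-domain) using () renaming (sum to sumᴿ)

-- Connects the sum in `LinearlyIndependent` with the one in `Independent`.
seq-sum : ∀ {n} (f : Fin n → ℝ) i → seq (sum f) i ≡ seq (sumᴿ f) i
seq-sum {zero}  f i = ≡.refl
seq-sum {suc n} f i = ≡.cong (seq (f zero) i ℚ.+_) (seq-sum (f ∘ suc) i)

linearlyIndependent⇒independent : ∀ {n k} (v : Fin k → Point n) → LinearlyIndependent v → Independent v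
linearlyIndependent⇒independent v indep c Σcv≈0 = indep c λ j → ≈-trans
  {sum (λ i → c i * v i j)} {sumᴿ (λ i → c i * v i j)} {0ℝ}
  (≗⇒≈ (sum (λ i → c i * v i j)) (sumᴿ (λ i → c i * v i j)) (seq-sum (λ i → c i * v i j))) (Σcv≈0 j)

module _ {n m k : ℕ} {L : Pred (Line n) 0ℓ} (lines : HasCardinality (Line-setoid n) L m)
         (joint : Fin k → Point n) (joint-inj : ∀ i j → joint i ≋ joint j → i ≡ j)
         (l : Fin k → Fin n → Line n) (l∈L : ∀ j i → L (l j i)) (joint∈l : ∀ j i → joint j ∈ˡ l j i)
         (l-independent : ∀ j → LinearlyIndependent (λ i → direction (l j i))) where

  private
    -- The line chosen at a joint need not be literally an enumerated one; surjectivity supplies one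
    -- with the same points.
    index : Fin k → Fin n → Fin m
    index j i = proj₁ (Bijection.surjective lines (l j i , l∈L j i))

    index-≈ˡ : ∀ j i → proj₁ (Bijection.to lines (index j i)) ≈ˡ l j i
    index-≈ˡ j i = proj₂ (Bijection.surjective lines (l j i , l∈L j i)) ≡.refl

    difference : ∀ {x x′} (l : Line n) → x ∈ˡ l → x′ ∈ˡ l → ∃[ t ] (∀ r → x′ r ≈ x r + t * direction l r)
    difference {x} {x′} l (s , x≈) (s′ , x′≈) = s′ + -ᴿ s , λ r → parameter-difference
      {base l r} {direction l r} {s} {s′} {x r} {x′ r} (x≈ r) (x′≈ r)

  jointsConfiguration : JointsConfiguration n m k
  jointsConfiguration = record
    { joint       = joint
    ; joint-inj   = joint-inj
    ; _on_        = λ j i → joint j ∈ˡ proj₁ (Bijection.to lines i)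
    ; through     = index
    ; on-through  = λ j i → Equivalence.from (index-≈ˡ j i (joint j)) (joint∈l j i)
    -- Taken from the chosen line, not the enumerated one, because independence is known for these
    -- vectors. Incidence passes between the two lines since `≈ˡ` compares points.
    ; direction   = λ j i → direction (l j i)
    ; independent = λ j → linearlyIndependent⇒independent (λ i → direction (l j i)) (l-independent j)
    ; parameter   = λ j i j′ on → difference {joint j} {joint j′} (l j i) (joint∈l j i)
                      (Equivalence.to (index-≈ˡ j i (joint j′)) on)
    }

#joints≤-injection : ∀ {n m k} {L : Pred (Line (suc n)) 0ℓ} → HasCardinality (Line-setoid (suc n)) L m →
  Injection (≡.setoid (Fin k)) (subsetoid (Point-setoid (suc n)) (IsJoint L)) →
  ∀ M → k ℕ.< M ℕ.^ suc n → k ℕ.≤ m ℕ.* (suc n ℕ.* M)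
#joints≤-injection lines joints = #joints≤ (jointsConfiguration lines
  (λ j → proj₁ (to j)) (λ i j → injective)
  (λ j → proj₁ (proj₂ (to j)))
  (λ j → proj₁ (proj₂ (proj₂ (to j))))
  (λ j → proj₁ (proj₂ (proj₂ (proj₂ (to j)))))
  (λ j → proj₂ (proj₂ (proj₂ (proj₂ (to j))))))
  where open Injection joints using (to; injective)

-- From the integer inequality to the real power

^-distribʳ-* : ∀ q m n → (m ℕ.* n) ℕ.^ q ≡ m ℕ.^ q ℕ.* n ℕ.^ q
^-distribʳ-* zero    m n = ≡.refl
^-distribʳ-* (suc q) m n = ≡.trans (≡.cong (m ℕ.* n ℕ.*_) (^-distribʳ-* q m n))
  (ℕ.[m*n]*[o*p]≡[m*o]*[n*p] m n (m ℕ.^ q) (n ℕ.^ q))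

^-cancelˡ-≤ : ∀ q .{{_ : ℕ.NonZero q}} {m n} → m ℕ.^ q ℕ.≤ n ℕ.^ q → m ℕ.≤ n
^-cancelˡ-≤ q h = ℕ.≮⇒≥ λ n<m → ℕ.<⇒≱ (ℕ.^-monoˡ-< q n<m) h

floorRoot-pos : ∀ q .{{_ : ℕ.NonZero q}} {b} → 0 ℕ.< b → 0 ℕ.< floorRoot q b
floorRoot-pos q {b} 0<b with floorRoot q b | floorRoot-> q b
... | zero  | b<1^q = contradiction (≡.subst (b ℕ.<_) (ℕ.^-zeroˡ q) b<1^q) (ℕ.≤⇒≯ 0<b)
... | suc _ | _     = s≤s z≤n

1+r≤2*r : ∀ {r} → 0 ℕ.< r → suc r ℕ.≤ 2 ℕ.* r
1+r≤2*r {r} 0<r = ℕ.≤-trans (ℕ.+-monoˡ-≤ r 0<r) (ℕ.≤-reflexive (≡.cong (r ℕ.+_) (≡.sym (ℕ.+-identityʳ r))))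

-- An integer above `(2n)^(n/(n-1))`: the exponent is at most `2` when `n` is at least `2`.
constant : ℕ → ℕ
constant n = (2 ℕ.* n) ℕ.* (2 ℕ.* n)

-- With `D` the floor of the `n`-th root of `k`, positivity of `k` gives `suc D ≤ 2 D`. The `n`-th
-- power of the hypothesis then bounds `k ^ n` by `D ^ n (2 n m) ^ n`, hence by `k (2 n m) ^ n`, and
-- one factor `k` cancels.
powerBound : ∀ q m k .{{_ : ℕ.NonZero q}} .{{_ : ℕ.NonZero k}} → let n = suc q in
  k ℕ.≤ m ℕ.* (n ℕ.* suc (floorRoot n k)) → k ℕ.^ q ℕ.≤ constant n ℕ.^ q ℕ.* m ℕ.^ n
powerBound q@(suc q′) m k k≤ = ℕ.*-cancelˡ-≤ k (begin
  k ℕ.^ n                                    ≤⟨ ℕ.^-monoˡ-≤ n (ℕ.≤-trans k≤ (ℕ.*-monoʳ-≤ m (ℕ.*-monoʳ-≤ n (1+r≤2*r (floorRoot-pos n (ℕ.>-nonZero⁻¹ k)))))) ⟩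
  (m ℕ.* (n ℕ.* (2 ℕ.* D))) ℕ.^ n            ≡⟨ ≡.cong (ℕ._^ n) (solve 4 (λ m n t D → m :* (n :* (t :* D)) := D :* ((t :* n) :* m)) ≡.refl m n 2 D) ⟩
  (D ℕ.* (2 ℕ.* n ℕ.* m)) ℕ.^ n              ≡⟨ ^-distribʳ-* n D (2 ℕ.* n ℕ.* m) ⟩
  D ℕ.^ n ℕ.* (2 ℕ.* n ℕ.* m) ℕ.^ n          ≤⟨ ℕ.*-monoˡ-≤ _ (floorRoot-≤ n k) ⟩
  k ℕ.* (2 ℕ.* n ℕ.* m) ℕ.^ n                ≡⟨ ≡.cong (k ℕ.*_) (^-distribʳ-* n (2 ℕ.* n) m) ⟩
  k ℕ.* ((2 ℕ.* n) ℕ.^ n ℕ.* m ℕ.^ n)        ≤⟨ ℕ.*-monoʳ-≤ k (ℕ.*-monoˡ-≤ (m ℕ.^ n) [2n]^n≤) ⟩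
  k ℕ.* (constant n ℕ.^ q ℕ.* m ℕ.^ n)       ∎)
  where
  open ℕ.≤-Reasoning
  open ℕSolver.+-*-Solver
  n = suc q
  D = floorRoot n k
  [2n]^n≤ : (2 ℕ.* n) ℕ.^ n ℕ.≤ constant n ℕ.^ q
  [2n]^n≤ = ℕ.≤-trans
    (ℕ.*-monoˡ-≤ ((2 ℕ.* n) ℕ.^ q) (ℕ.m≤m*n (2 ℕ.* n) ((2 ℕ.* n) ℕ.^ q′) {{ℕ.m^n≢0 (2 ℕ.* n) q′}}))
    (ℕ.≤-reflexive (≡.sym (^-distribʳ-* q (2 ℕ.* n) (2 ℕ.* n))))

-- The comparison of `k` with the `i`-th term `r / (i + 1)` of the real root, cleared of
-- denominators. It follows by taking `q`-th powers; the factor `2` absorbs the rounding through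
-- `suc r ≤ 2 r`.
numeratorBound : ∀ q m k .{{_ : ℕ.NonZero q}} → let n = suc q in
  k ℕ.≤ m ℕ.* (n ℕ.* suc (floorRoot n k)) →
  ∀ i → k ℕ.* suc i ℕ.≤ 2 ℕ.* constant n ℕ.* rootNumerator q (m ℕ.^ n) i
numeratorBound q m       zero      _  i = z≤n
-- For positive `k` the hypothesis excludes `m = 0`, and positive `m` makes the numerator `r`
-- positive.
numeratorBound q m@(suc _) k@(suc _) k≤ i = begin
  k ℕ.* suc i               ≤⟨ ^-cancelˡ-≤ q power≤ ⟩
  c ℕ.* suc r               ≤⟨ ℕ.*-monoʳ-≤ c (1+r≤2*r (floorRoot-pos q (ℕ.>-nonZero⁻¹ (m ℕ.^ n ℕ.* suc i ℕ.^ q) {{b≢0}}))) ⟩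
  c ℕ.* (2 ℕ.* r)           ≡⟨ solve 3 (λ c t r → c :* (t :* r) := t :* c :* r) ≡.refl c 2 r ⟩
  2 ℕ.* c ℕ.* r             ∎
  where
  open ℕ.≤-Reasoning
  open ℕSolver.+-*-Solver
  n = suc q
  c = constant n
  r = rootNumerator q (m ℕ.^ n) i
  b≢0 : ℕ.NonZero (m ℕ.^ n ℕ.* suc i ℕ.^ q)
  b≢0 = ℕ.m*n≢0 (m ℕ.^ n) (suc i ℕ.^ q) {{ℕ.m^n≢0 m n}} {{ℕ.m^n≢0 (suc i) q}}
  power≤ : (k ℕ.* suc i) ℕ.^ q ℕ.≤ (c ℕ.* suc r) ℕ.^ q
  power≤ = begin
    (k ℕ.* suc i) ℕ.^ q                       ≡⟨ ^-distribʳ-* q k (suc i) ⟩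
    k ℕ.^ q ℕ.* suc i ℕ.^ q                   ≤⟨ ℕ.*-monoˡ-≤ (suc i ℕ.^ q) (powerBound q m k k≤) ⟩
    c ℕ.^ q ℕ.* m ℕ.^ n ℕ.* suc i ℕ.^ q       ≡⟨ ℕ.*-assoc (c ℕ.^ q) (m ℕ.^ n) (suc i ℕ.^ q) ⟩
    c ℕ.^ q ℕ.* (m ℕ.^ n ℕ.* suc i ℕ.^ q)     ≤⟨ ℕ.*-monoʳ-≤ (c ℕ.^ q) (ℕ.<⇒≤ (floorRoot-> q (m ℕ.^ n ℕ.* suc i ℕ.^ q))) ⟩
    c ℕ.^ q ℕ.* suc r ℕ.^ q                   ≡⟨ ^-distribʳ-* q c (suc r) ⟨
    (c ℕ.* suc r) ℕ.^ q                       ∎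

/-≤ : ∀ k C r i → k ℕ.* suc i ℕ.≤ C ℕ.* r → + k ℚ./ 1 ℚ.≤ (+ C ℚ./ 1) ℚ.* (+ r ℚ./ suc i)
/-≤ k C r i h = ℚ.toℚᵘ-cancel-≤ (begin
  ℚ.toℚᵘ (+ k ℚ./ 1)                              ≃⟨ ℚ.toℚᵘ-fromℚᵘ (ℚᵘ.mkℚᵘ (+ k) 0) ⟩
  ℚᵘ.mkℚᵘ (+ k) 0                                 ≤⟨ ℚᵘ.*≤* (≡.subst₂ ℤ._≤_ lhs rhs (ℤ.+≤+ h)) ⟩
  ℚᵘ.mkℚᵘ (+ C) 0 ℚᵘ.* ℚᵘ.mkℚᵘ (+ r) i            ≃⟨ ℚᵘ.*-cong (ℚ.toℚᵘ-fromℚᵘ (ℚᵘ.mkℚᵘ (+ C) 0)) (ℚ.toℚᵘ-fromℚᵘ (ℚᵘ.mkℚᵘ (+ r) i)) ⟨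
  ℚ.toℚᵘ (+ C ℚ./ 1) ℚᵘ.* ℚ.toℚᵘ (+ r ℚ./ suc i)  ≃⟨ ℚ.toℚᵘ-homo-* (+ C ℚ./ 1) (+ r ℚ./ suc i) ⟨
  ℚ.toℚᵘ ((+ C ℚ./ 1) ℚ.* (+ r ℚ./ suc i))        ∎)
  where
  open ℚᵘ.≤-Reasoning
  lhs : + (k ℕ.* suc i) ≡ + k ℤ.* + (suc i ℕ.+ 0)
  lhs = ≡.trans (≡.cong (λ j → + (k ℕ.* j)) (≡.sym (ℕ.+-identityʳ (suc i)))) (ℤ.pos-* k (suc i ℕ.+ 0))
  rhs : + (C ℕ.* r) ≡ + C ℤ.* + r ℤ.* + 1
  rhs = ≡.trans (ℤ.pos-* C r) (≡.sym (ℤ.*-identityʳ (+ C ℤ.* + r)))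

theorem1 : ∀ n (2≤n : 2 ℕ.≤ n) →
    ∃[ C ] (0ℝ < C ×
    ((L : Pred (Line n) 0ℓ) → L Respects _≈ˡ_ →
    (m : ℕ) → HasCardinality (Line-setoid n) L m →
    CardinalityAtMost (Point-setoid n) (IsJoint L)
    (C * (m ^[ n / n ∸ 1 ]) {{2≤n⇒n∸1≢0 2≤n}})))
theorem1 n@(suc q@(suc _)) 2≤n@(s≤s (s≤s _)) =
  -- The rational `C` itself is the gap separating `0` from `C`.
  fromℕ C , (+ C ℚ./ 1 , 0<C , 0 , λ i _ → ℚ.≤-reflexive (ℚ.+-identityˡ (+ C ℚ./ 1))) ,
  -- The inequality holds at every index, hence the threshold `0`; the slack `ε` only makes it
  -- strict.
  λ L _ m lines k joints ε 0<ε → 0 , λ i _ →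
    ≡.subst (ℚ._< _) (ℚ.+-identityʳ (+ k ℚ./ 1)) (ℚ.+-mono-≤-<
      (/-≤ k C (rootNumerator q (m ℕ.^ n) i) i
        (numeratorBound q m k
          -- `suc (floorRoot n k)` is the least `M` with `k < M ^ n`.
          (#joints≤-injection lines joints (suc (floorRoot n k)) (floorRoot-> n k)) i))
      0<ε)
  where
  C = 2 ℕ.* constant n
  0<C : 0ℚ ℚ.< + C ℚ./ 1
  0<C = ℚ.positive⁻¹ (+ C ℚ./ 1) {{ℚ.normalize-pos C 1}}
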